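{- On HDAs over $\Sigma$, hp-bisimilarity is strictly contained in qhp-bisimilarity: ${\underline{\leftrightarrow}_{hp}}\subsetneq{\underline{\leftrightarrow}_{qhp}}$.
   Context: HDAs. $\Sigma$ is a fixed set of actions, containing pairwise distinct actions $a,b,c,d$. A conclist is $U=(n,\lambda)$ with $n\in\mathbb N$ and $\lambda:\{1<\dots<n\}\to\Sigma$. The category $\square$ has conclists as objects; a morphism $(m,\lambda)\to(n,\mu)$ is a pair $(f,\varepsilon)$ with $f:\{1,\dots,m\}\to\{1,\dots,n\}$ injective, order- and label-preserving, and $\varepsilon:\{1,\dots,n\}\to\{0,*,1\}$ with $\varepsilon^{ -1}(*)=\mathrm{im} f$; composition is $(g,\zeta)\circ(f,\varepsilon)=(g\circ f,\eta)$ with $\eta(g(t))=\varepsilon(t)$ and $\eta(u)=\zeta(u)$ for $u\notin\mathrm{im}\,g$. For $1\le i\le n$, $k\in\{0,1\}$, the coface map $d_i^k:U\to V$ ($V$ of dimension $n$, $U$ of dimension $n-1$) has $f$ omitting position $i$, $\varepsilon(i)=k$, and $\varepsilon(j)=*$ for $j\ne i$. A precubical set is a functor $X:\square^{op}\to\mathbf{Set}$; elements of $X[U]$, $U=(n,\lambda)$, are $n$-dimensional cells, and $\delta_i^k:=X[d_i^k]$. An HDA is a pair $(X,i)$ of a precubical set and an initial $0$-dimensional cell $i$. Paths. A path of an HDA $\mathcal X$ is a sequence $\alpha=(x_0,\varphi_1,x_1,\dots,\varphi_n,x_n)$ ($n\ge 0$) with $x_0$ the initial cell, $x_j\in X[U_j]$,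 where for each $j$ either $\varphi_j=d^0_{i_j}:U_{j-1}\to U_j$ with $x_{j-1}=\delta^0_{i_j}(x_j)$ (up-step, starting an event) or $\varphi_j=d^1_{i_j}:U_j\to U_{j-1}$ with $x_j=\delta^1_{i_j}(x_{j-1})$ (down-step, ending an event). $\alpha\hookrightarrow\alpha'$ means $\alpha$ is a prefix of $\alpha'$. $\alpha\leftrightarrows^\ell\beta$ ($\ell$-similarity): one of $\alpha,\beta$ is obtained from the other by replacing, around the cell $x_\ell$, $(d_i^0,x_\ell,d_j^0)$ by $(d_{j-1}^0,x'_\ell,d_i^0)$, or $(d_j^1,x_\ell,d_i^1)$ by $(d_i^1,x'_\ell,d_{j-1}^1)$, for some $i<j$ and some cell $x'_\ell$. $\alpha\sqsubseteq^\ell\beta$ ($\beta$ subsumes $\alpha$ at $\ell$): $\alpha$ is obtained from $\beta$ by replacing, around $x_\ell$, $(d_i^0,x_\ell,d_j^1)$ by $(d_{j-1}^1,x'_\ell,d_i^0)$, or $(d_j^0,x_\ell,d_i^1)$ by $(d_i^1,x'_\ell,d_{j-1}^0)$, for some $i<j$. ST-traces. Given a down-step at position $p$ of a path, move it to the left: as long as the step directly before it is a down-step, or an up-step whose index differs from the current index of the moving down-step, there is a unique replacement moving it one position left: for some $i<j$ and cells $x,x'$, it replaces $(d_j^1,x,d_i^1)$ by $(d_i^1,x',d_{j-1}^1)$ or conversely (if the step directly before is a down-step), or it replaces $(d_i^0,x,d_j^1)$ by $(d_{j-1}^1,x',d_i^0)$ or $(d_j^0,x,d_i^1)$ by $(d_i^1,x',d_{j-1}^0)$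 (if the step directly before is an up-step). This stops when the step directly before it, at position $k$, is an up-step with the same index; put $\mathrm{start}(p)=k$. $\mathsf{ST}(\alpha)$ is the sequence whose $j$-th entry is $a^+$ if $\varphi_j$ is an up-step starting an event labelled $a$ (the label of the $i_j$-th event of $U_j$), and $a^{\mathrm{start}(j)}$ if $\varphi_j$ is a down-step ending an event labelled $a$ (the label of the $i_j$-th event of $U_{j-1}$). $I$-bisimulations. For $I\subseteq\{\sqsubseteq,\sqsupseteq,\leftrightarrows,\hookleftarrow\}$, an $I$-bisimulation between HDAs $\mathcal Y,\mathcal Z$ is a relation $\mathfrak R$ between paths of $\mathcal Y$ and of $\mathcal Z$ satisfying the following clauses, each also with the roles of $\mathcal Y$ and $\mathcal Z$ exchanged: (1) the length-$0$ paths of $\mathcal Y$ and $\mathcal Z$ are related; (2) if $(\alpha,\beta)\in\mathfrak R$ then $\mathsf{ST}(\alpha)=\mathsf{ST}(\beta)$; (3) if $(\alpha,\beta)\in\mathfrak R$ and $\alpha\hookrightarrow\alpha'$, there is $\beta'$ with $\beta\hookrightarrow\beta'$ and $(\alpha',\beta')\in\mathfrak R$; and those of the following whose symbol lies in $I$: ($\sqsubseteq$) if $(\alpha,\beta)\in\mathfrak R$ and $\alpha\sqsubseteq^\ell\alpha'$, there is $\beta'$ with $\beta\sqsubseteq^\ell\beta'$, $(\alpha',\beta')\in\mathfrak R$; ($\sqsupseteq$) the same with $\alpha'\sqsubseteq^\ell\alpha$ and $\beta'\sqsubseteq^\ell\beta$; ($\leftrightarrows$) the same with $\alpha'\leftrightarrows^\ell\alpha$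 and $\beta'\leftrightarrows^\ell\beta$; ($\hookleftarrow$) the same with $\alpha'\hookrightarrow\alpha$ and $\beta'\hookrightarrow\beta$. $\mathcal Y,\mathcal Z$ are $I$-bisimilar, $\mathcal Y\,\underline{\leftrightarrow}_I\,\mathcal Z$, if an $I$-bisimulation between them exists. Names: qhp is $I=\{\sqsubseteq,\leftrightarrows\}$; hp is $I=\{\sqsubseteq,\sqsupseteq,\leftrightarrows\}$. -}

module Defs where

open import Level using (0ℓ)
open import Data.Nat.Base using (ℕ; zero; suc)
open import Data.Fin.Base using (Fin; zero; suc; toℕ; punchIn; punchOut)
  renaming (_≤_ to _≤ᶠ_)
open import Data.Fin.Properties
  using (_≟_; any?; toℕ-injective; punchInᵢ≢i; punchIn-injective; punchIn-mono-≤; punchIn-punchOut)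
open import Data.Nat.Properties using (suc-injective; <⇒≢)
open import Data.List.Base using (List; []; _∷ʳ_)
open import Data.Product.Base using (Σ; ∃; ∃-syntax; _×_; _,_; proj₁)
open import Data.Sum.Base using (_⊎_; inj₁; inj₂)
open import Data.Vec.Base using (Vec; []; _∷_; lookup; removeAt)
open import Function.Base using (flip)
open import Function.Bundles using (_⇔_; mk⇔; Equivalence)
open import Function.Definitions using (Injective)
open import Relation.Binary.Core using (REL)
open import Relation.Binary.PropositionalEquality
  using (_≡_; _≢_; refl; sym; trans; cong; subst)
open import Relation.Nullary using (yes; no; contradiction)
open import Relation.Unary using (Pred; _∈_; ｛_｝; _∪_)
import Data.Nat.Base as ℕ

-- (n , λ), with λ : {1 < ⋯ < n} → Act given by its table of values, so that
-- propositional equality of conclists is extensional.  Positions are counted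
-- from 0.
Conclist : Set → Set
Conclist Act = Σ ℕ (Vec Act)

data Bit : Set where
  0₂ 1₂ : Bit

data Coord : Set where
  *  : Coord
  at : Bit → Coord

module _ {Act : Set} where

  dim : Conclist Act → ℕ
  dim = proj₁

  label : (U : Conclist Act) → Fin (dim U) → Act
  label (_ , v) = lookup v

  record Hom (U V : Conclist Act) : Set where
    field
      f         : Fin (dim U) → Fin (dim V)
      injective : Injective _≡_ _≡_ f
      monotone  : ∀ {s t} → s ≤ᶠ t → f s ≤ᶠ f t
      labelled  : ∀ t → label V (f t) ≡ label U t
      ε         : Fin (dim V) → Coord
      image     : ∀ u → ε u ≡ * ⇔ (∃[ t ] f t ≡ u)

  open Hom

  infix 4 _≈_
  _≈_ : {U V : Conclist Act} → Hom U V → Hom U V → Set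
  g ≈ h = (∀ t → f g t ≡ f h t) × (∀ u → ε g u ≡ ε h u)

  idₕ : ∀ {U} → Hom U U
  idₕ = record
    { f         = λ t → t
    ; injective = λ e → e
    ; monotone  = λ le → le
    ; labelled  = λ _ → refl
    ; ε         = λ _ → *
    ; image     = λ u → mk⇔ (λ _ → u , refl) (λ _ → refl)
    }

  infixr 9 _∘ₕ_
  _∘ₕ_ : ∀ {U V W} → Hom V W → Hom U V → Hom U W
  _∘ₕ_ {U} {V} {W} g h = record
    { f         = λ t → f g (f h t)
    ; injective = λ e → injective h (injective g e)
    ; monotone  = λ le → monotone g (monotone h le)
    ; labelled  = λ t → trans (labelled g (f h t)) (labelled h t)
    ; ε         = η
    ; image     = λ u → mk⇔ (to u) (from u)
    }
    where
    η : Fin (dim W) → Coord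
    η u with any? (λ t → f g t ≟ u)
    ... | yes (t , _) = ε h t
    ... | no  _       = ε g u

    to : ∀ u → η u ≡ * → ∃[ s ] f g (f h s) ≡ u
    to u e with any? (λ t → f g t ≟ u)
    ... | no  ∉im = contradiction (Equivalence.to (image g u) e) ∉im
    ... | yes (t , gt≡u) with Equivalence.to (image h t) e
    ...   | s , hs≡t = s , trans (cong (f g) hs≡t) gt≡u

    from : ∀ u → (∃[ s ] f g (f h s) ≡ u) → η u ≡ *
    from u (s , e) with any? (λ t → f g t ≟ u)
    ... | no  ∉im        = contradiction (f h s , e) ∉im
    ... | yes (t , gt≡u) =
      Equivalence.from (image h t) (s , injective g (trans e (sym gt≡u)))

  lookup-removeAt : ∀ {n} (v : Vec Act (suc n)) i t →
                    lookup v (punchIn i t) ≡ lookup (removeAt v i) t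
  lookup-removeAt (_ ∷ _)     zero    t       = refl
  lookup-removeAt (_ ∷ _ ∷ _) (suc i) zero    = refl
  lookup-removeAt (_ ∷ x ∷ v) (suc i) (suc t) = lookup-removeAt (x ∷ v) i t

  coface : ∀ {n} (k : Bit) (v : Vec Act (suc n)) (i : Fin (suc n)) →
           Hom (n , removeAt v i) (suc n , v)
  coface {n} k v i = record
    { f         = punchIn i
    ; injective = λ {s} {t} → punchIn-injective i s t
    ; monotone  = λ {s} {t} → punchIn-mono-≤ i s t
    ; labelled  = lookup-removeAt v i
    ; ε         = pin
    ; image     = λ u → mk⇔ (to u) (from u)
    }
    where
    pin : Fin (suc n) → Coord
    pin u with i ≟ u
    ... | yes _ = at k
    ... | no  _ = *

    to : ∀ u → pin u ≡ * → ∃[ t ] punchIn i t ≡ u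
    to u e with i ≟ u
    to u () | yes _
    to u _  | no i≢u = punchOut i≢u , punchIn-punchOut i≢u

    from : ∀ u → (∃[ t ] punchIn i t ≡ u) → pin u ≡ *
    from u (t , e) with i ≟ u
    ... | yes i≡u = contradiction (trans e (sym i≡u)) (punchInᵢ≢i i t)
    ... | no  _   = refl

record Precubical (Act : Set) : Set₁ where
  field
    _[_]         : Conclist Act → Set
    ⟪_⟫          : ∀ {U V} → Hom U V → _[_] V → _[_] U
    resp-≈       : ∀ {U V} {g h : Hom U V} → g ≈ h → ∀ x → ⟪ g ⟫ x ≡ ⟪ h ⟫ x
    identity     : ∀ {U} (x : _[_] U) → ⟪ idₕ ⟫ x ≡ x
    homomorphism : ∀ {U V W} (g : Hom V W) (h : Hom U V) (x : _[_] W) →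
                   ⟪ g ∘ₕ h ⟫ x ≡ ⟪ h ⟫ (⟪ g ⟫ x)

record HDA (Act : Set) : Set₁ where
  field
    precubical : Precubical Act
  open Precubical precubical public
  field
    initial : _[_] (0 , [])

module _ {Act : Set} where

  module _ (X : HDA Act) where
    open HDA X

    Cell : Set
    Cell = Σ (Conclist Act) _[_]

    initialCell : Cell
    initialCell = (0 , []) , initial

    Pos : Cell → Set
    Pos (U , _) = Fin (dim U)

    δ : (k : Bit) (x : Cell) → Pos x → Cell
    δ k ((suc n , v) , x) i = (n , removeAt v i) , ⟪ coface k v i ⟫ x

  data Step (X : HDA Act) (x y : Cell X) : Set where
    up   : (i : Pos X y) → x ≡ δ X 0₂ y i → Step X x y
    down : (i : Pos X x) → y ≡ δ X 1₂ x i → Step X x y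

  -- Run X x consists of the paths whose last cell is x.
  infixl 5 _▷_
  data Run (X : HDA Act) : Cell X → Set where
    init : Run X (initialCell X)
    _▷_  : ∀ {x y} → Run X x → Step X x y → Run X y

  Path : HDA Act → Set
  Path X = ∃ (Run X)

  module _ {X : HDA Act} where

    emptyPath : Path X
    emptyPath = initialCell X , init

    length : ∀ {x} → Run X x → ℕ
    length init    = 0
    length (α ▷ _) = suc (length α)

    infix 4 _↪_
    data _↪_ (α : Path X) : Path X → Set where
      done   : α ↪ α
      extend : ∀ {x y} {β : Run X x} (s : Step X x y) →
               α ↪ (x , β) → α ↪ (y , β ▷ s)

    -- Two consecutive steps x → y → z are replaced by x → y′ → z.
    Replacement : Set₁
    Replacement = ∀ {x y y′ z : Cell X} →
                  Step X x y → Step X y z → Step X x y′ → Step X y′ z → Set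

    -- The index pattern is i < j on one side and (j - 1 , i) on the other.
    -- The positions have different types, hence they are compared as naturals.
    data Swap {x y y′ z : Cell X} :
      Step X x y → Step X y z → Step X x y′ → Step X y′ z → Set where
      up-up     : ∀ {i j j-1 i′ p q p′ q′} →
                  toℕ i ℕ.< toℕ j → toℕ j ≡ suc (toℕ j-1) → toℕ i ≡ toℕ i′ →
                  Swap (up i p) (up j q) (up j-1 p′) (up i′ q′)
      down-down : ∀ {i j j-1 i′ p q p′ q′} →
                  toℕ i ℕ.< toℕ j → toℕ j ≡ suc (toℕ j-1) → toℕ i ≡ toℕ i′ →
                  Swap (down j p) (down i q) (down i′ p′) (down j-1 q′)

    data Serialise {x y y′ z : Cell X} :
      Step X x y → Step X y z → Step X x y′ → Step X y′ z → Set where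
      lower-up   : ∀ {i j j-1 i′ p q p′ q′} →
                   toℕ i ℕ.< toℕ j → toℕ j ≡ suc (toℕ j-1) → toℕ i ≡ toℕ i′ →
                   Serialise (up i p) (down j q) (down j-1 p′) (up i′ q′)
      lower-down : ∀ {i j j-1 i′ p q p′ q′} →
                   toℕ i ℕ.< toℕ j → toℕ j ≡ suc (toℕ j-1) → toℕ i ≡ toℕ i′ →
                   Serialise (up j p) (down i q) (down i′ p′) (up j-1 q′)

    -- Replace P ℓ α β: β is obtained from α by a replacement in P around x_ℓ.
    data Replace (P : Replacement) : ℕ → Path X → Path X → Set where
      here  : ∀ {x y y′ z} {α : Run X x} {s : Step X x y} {t : Step X y z}
              {s′ : Step X x y′} {t′ : Step X y′ z} → P s t s′ t′ →
              Replace P (suc (length α)) (z , α ▷ s ▷ t) (z , α ▷ s′ ▷ t′)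
      later : ∀ {ℓ x y} {α β : Run X x} (s : Step X x y) →
              Replace P ℓ (x , α) (x , β) → Replace P ℓ (y , α ▷ s) (y , β ▷ s)

    infix 4 _⇆[_]_ _⊑[_]_
    _⇆[_]_ : Path X → ℕ → Path X → Set
    α ⇆[ ℓ ] β = Replace Swap ℓ α β ⊎ Replace Swap ℓ β α

    _⊑[_]_ : Path X → ℕ → Path X → Set
    α ⊑[ ℓ ] β = Replace Serialise ℓ β α

    passUp : ∀ k (y : Cell X) {i m : Pos X y} → i ≢ m → Pos X (δ X k y i)
    passUp k ((suc _ , _) , _) i≢m = punchOut i≢m

    passDown : ∀ k (x : Cell X) (i : Pos X x) → Pos X (δ X k x i) → Pos X x
    passDown k ((suc _ , _) , _) i m = punchIn i m

    -- start α m is start(p) for a down-step at position p = length α + 1 that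
    -- extends α and has index m.  Moving it in front of the last step of α
    -- yields a down-step extending the rest of α, with new index
    -- * m or m - 1, according as m < i or m > i, if the last step of α is an
    --   up-step of index i ≠ m; this is punchOut;
    -- * m or m + 1, according as m < i or m ≥ i, if the last step of α is a
    --   down-step of index i; this is punchIn i m.
    -- See start-move below.
    start : ∀ {x} → Run X x → Pos X x → ℕ
    start init ()
    start (_▷_ {y = y} α (up i refl)) m with i ≟ m
    ... | yes _   = suc (length α)
    ... | no  i≢m = start α (passUp 0₂ y i≢m)
    start (_▷_ {x = x} α (down i refl)) m = start α (passDown 1₂ x i m)

    private
      punchIn-< : ∀ {n} {i : Fin (suc n)} {m : Fin n} →
                  toℕ m ℕ.< toℕ i → toℕ (punchIn i m) ≡ toℕ m
      punchIn-< {i = suc i} {zero}  _           = refl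
      punchIn-< {i = suc i} {suc m} (ℕ.s≤s m<i) = cong suc (punchIn-< m<i)

      punchIn-≥ : ∀ {n} {i : Fin (suc n)} {m : Fin n} →
                  toℕ i ℕ.≤ toℕ m → toℕ (punchIn i m) ≡ suc (toℕ m)
      punchIn-≥ {i = zero}          _           = refl
      punchIn-≥ {i = suc i} {suc m} (ℕ.s≤s i≤m) = cong suc (punchIn-≥ i≤m)

      punchOut-< : ∀ {n} {i m : Fin (suc n)} (i≢m : i ≢ m) →
                   toℕ m ℕ.< toℕ i → toℕ (punchOut i≢m) ≡ toℕ m
      punchOut-< {suc n} {suc i} {zero}  _   _           = refl
      punchOut-< {suc n} {suc i} {suc m} i≢m (ℕ.s≤s m<i) =
        cong suc (punchOut-< (λ e → i≢m (cong suc e)) m<i)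

      punchOut-> : ∀ {n} {i m : Fin (suc n)} (i≢m : i ≢ m) →
                   toℕ i ℕ.< toℕ m → suc (toℕ (punchOut i≢m)) ≡ toℕ m
      punchOut-> {_}     {zero}  {suc m} _   _           = refl
      punchOut-> {suc n} {suc i} {suc m} i≢m (ℕ.s≤s i<m) =
        cong suc (punchOut-> (λ e → i≢m (cong suc e)) i<m)

    -- The index bookkeeping of start agrees with the replacements.
    start-move : ∀ {x y y′ z} (α : Run X x) {s : Step X x y} {m q m′ p′}
                 {s′ : Step X y′ z} →
                 Serialise s (down m q) (down m′ p′) s′ ⊎
                 Swap s (down m q) (down m′ p′) s′ ⊎
                 Swap (down m′ p′) s′ s (down m q) →
                 start (α ▷ s) m ≡ start α m′
    start-move {y = (suc _ , _) , _} α
      (inj₁ (lower-up {i = i} {j = j} {p = refl} i<j j≡ _)) with i ≟ j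
    ... | yes i≡j = contradiction (cong toℕ i≡j) (<⇒≢ i<j)
    ... | no  i≢j = cong (start α) (toℕ-injective
                      (suc-injective (trans (punchOut-> i≢j i<j) j≡)))
    start-move {y = (suc _ , _) , _} α
      (inj₁ (lower-down {i = i} {j = j} {p = refl} i<j _ i≡)) with j ≟ i
    ... | yes j≡i = contradiction (cong toℕ (sym j≡i)) (<⇒≢ i<j)
    ... | no  j≢i = cong (start α) (toℕ-injective
                      (trans (punchOut-< j≢i i<j) i≡))
    start-move {x = (suc _ , _) , _} α
      (inj₂ (inj₁ (down-down {p = refl} i<j _ i≡))) =
      cong (start α) (toℕ-injective (trans (punchIn-< i<j) i≡))
    start-move {x = (suc _ , _) , _} α
      (inj₂ (inj₂ (down-down {i = i} {p′ = refl} i<j j≡ i≡))) =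
      cong (start α) (toℕ-injective (trans (punchIn-≥
        (subst (ℕ._≤ _) i≡ (ℕ.s≤s⁻¹ (subst (_ ℕ.<_) j≡ i<j)))) (sym j≡)))

  infix 8 _⁺ _^_
  data Entry : Set where
    _⁺  : Act → Entry
    _^_ : Act → ℕ → Entry

  traceOf : {X : HDA Act} {x : Cell X} → Run X x → List Entry
  traceOf init = []
  traceOf (_▷_ {y = U , _} α (up i _))   = traceOf α ∷ʳ label U i ⁺
  traceOf (_▷_ {x = U , _} α (down i _)) = traceOf α ∷ʳ label U i ^ start α i

  ST : {X : HDA Act} → Path X → List Entry
  ST (_ , α) = traceOf α

data Symbol : Set where
  ⊑ ⊒ ⇆ ↩ : Symbol

module _ {Act : Set} where

  record IsSimulation (I : Pred Symbol 0ℓ) {Y Z : HDA Act}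
                      (R : REL (Path Y) (Path Z) 0ℓ) : Set where
    field
      empty   : R emptyPath emptyPath
      trace   : ∀ {α β} → R α β → ST α ≡ ST β
      forward : ∀ {α β α′} → R α β → α ↪ α′ →
                ∃[ β′ ] β ↪ β′ × R α′ β′
      ⊑-move  : ⊑ ∈ I → ∀ {ℓ α β α′} → R α β → α ⊑[ ℓ ] α′ →
                ∃[ β′ ] β ⊑[ ℓ ] β′ × R α′ β′
      ⊒-move  : ⊒ ∈ I → ∀ {ℓ α β α′} → R α β → α′ ⊑[ ℓ ] α →
                ∃[ β′ ] β′ ⊑[ ℓ ] β × R α′ β′
      ⇆-move  : ⇆ ∈ I → ∀ {ℓ α β α′} → R α β → α′ ⇆[ ℓ ] α →
                ∃[ β′ ] β′ ⇆[ ℓ ] β × R α′ β′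
      ↩-move  : ↩ ∈ I → ∀ {α β α′} → R α β → α′ ↪ α →
                ∃[ β′ ] β′ ↪ β × R α′ β′

  record IsBisimulation (I : Pred Symbol 0ℓ) {Y Z : HDA Act}
                        (R : REL (Path Y) (Path Z) 0ℓ) : Set where
    field
      there : IsSimulation I R
      back  : IsSimulation I (flip R)

  infix 4 _↔[_]_
  _↔[_]_ : HDA Act → Pred Symbol 0ℓ → HDA Act → Set₁
  Y ↔[ I ] Z = Σ (REL (Path Y) (Path Z) 0ℓ) (IsBisimulation I)

qhp hp : Pred Symbol 0ℓ
qhp = ｛ ⊑ ｝ ∪ ｛ ⇆ ｝
hp  = ｛ ⊑ ｝ ∪ ｛ ⊒ ｝ ∪ ｛ ⇆ ｝

module Submission where

open import Defs
open import Axiom.UniquenessOfIdentityProofs.WithK using (uip)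
open import Data.Bool.Base using (Bool; true; false; not; if_then_else_; T)
open import Data.Bool.Properties using (not-involutive)
open import Data.Fin.Base using (Fin; zero; suc; toℕ) renaming (_≤_ to _≤ᶠ_)
open import Data.Fin.Properties using (_≟_; _≤?_; any?; ≤-antisym; suc-injective)
open import Data.List.Base using (List; []; _∷_; _∷ʳ_)
open import Data.List.Properties using (∷ʳ-injectiveˡ; ∷ʳ-injectiveʳ)
open import Data.List.Relation.Unary.Unique.Propositional using (Unique)
open import Data.Maybe.Base using (Maybe; just; nothing; is-just)
open import Data.Nat.Base using (ℕ; zero; suc; z≤n; s≤s; _≡ᵇ_)
open import Data.Nat.Properties using (≡ᵇ⇒≡)
open import Data.Product.Base using (Σ; ∃; ∃₂; ∃-syntax; _×_; _,_; proj₁; proj₂; map₂)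
open import Data.Sum.Base using (_⊎_; inj₁; inj₂)
open import Data.Unit.Base using (⊤; tt)
open import Data.Vec.Base
  using (Vec; []; _∷_; lookup; map; tabulate; removeAt; _[_]≔_; replicate; allFin)
open import Data.Vec.Properties
  using (lookup-map; lookup∘tabulate; tabulate∘lookup; tabulate-cong; lookup∘update;
         lookup∘update′; lookup-replicate; lookup-allFin)
open import Data.Vec.Relation.Unary.Unique.Propositional.Properties using (lookup-injective)
open import Function.Base using (_∘_; id)
open import Function.Bundles using (_⇔_; mk⇔; Equivalence)
open import Function.Definitions using (Injective)
open import Level using (0ℓ)
open import Relation.Binary.Core using (REL)
open import Relation.Binary.PropositionalEquality
open import Relation.Nullary using (Dec; yes; no; ¬_; contradiction)
open import Relation.Nullary.Decidable using (recompute)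
open import Relation.Unary using (Pred)
import Data.List.Relation.Unary.All as List
import Data.List.Relation.Unary.AllPairs as List
import Data.Nat.Base as ℕ
import Data.Vec.Relation.Unary.All as Vec
import Data.Vec.Relation.Unary.AllPairs as Vec

-- Take the cube on three events a, b, c and replace some of its faces by several
-- copies.  The edges "a has ended, b is running, c has not started" and "b has
-- ended, a is running, c has not started" get two copies true and false each.
-- The square on a and b before c gets three: nothing, with both edges true, and
-- just x, with edges x and σ x.  Each edge extends along c to a square, but of
-- the squares on a and b only those of the form just x extend to a cube.  Let Y
-- be given by σ = id and Z by σ = not.
--
-- An edge true bounds one square that lies under a cube and one that does not,
-- an edge false only one under a cube, and this holds in Y as well as in Z.
-- Hence relating paths with the same shadow in the cube whenever the first
-- copied cell that they visit has the same type (its copy, for an edge, and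
-- whether it lies under a cube, for a square) is a qhp-bisimulation: once a
-- path has visited a square, the copies of its edges no longer matter.
--
-- In an hp-bisimulation, a path through a cube of Y with both edges true is
-- related to one through a cube of Z, which has an edge false.  Serialising so
-- that only this edge is visited, Y can continue to the square nothing, and Z
-- only to the square under the cube.

-- Vectors and monotone injections

lookup-ext : ∀ {A : Set} {n} {xs ys : Vec A n} → (∀ i → lookup xs i ≡ lookup ys i) → xs ≡ ys
lookup-ext {xs = xs} {ys} eq =
  trans (sym (tabulate∘lookup xs)) (trans (tabulate-cong eq) (tabulate∘lookup ys))

star? : (x : Coord) → Dec (x ≡ *)
star? *      = yes refl
star? (at _) = no λ ()

-- Both maps send `zero` to the least element of their common image; removing it leaves the same
-- situation one size down.
monotone-unique : ∀ {n N} {p q : Fin n → Fin N} →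
  Injective _≡_ _≡_ p → Injective _≡_ _≡_ q →
  (∀ {s t} → s ≤ᶠ t → p s ≤ᶠ p t) → (∀ {s t} → s ≤ᶠ t → q s ≤ᶠ q t) →
  (∀ s → ∃[ t ] q t ≡ p s) → (∀ s → ∃[ t ] p t ≡ q s) → ∀ s → p s ≡ q s
monotone-unique {suc n} {N} {p} {q} p-inj q-inj p-mono q-mono p⊆q q⊆p = go
  where
  0≡ : p zero ≡ q zero
  0≡ with p⊆q zero | q⊆p zero
  ... | t , qt≡p0 | s , ps≡q0 =
    ≤-antisym (subst (p zero ≤ᶠ_) ps≡q0 (p-mono z≤n)) (subst (q zero ≤ᶠ_) qt≡p0 (q-mono z≤n))

  shrink : ∀ {p q : Fin (suc n) → Fin N} → Injective _≡_ _≡_ p → p zero ≡ q zero →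
           (∀ s → ∃[ t ] q t ≡ p s) → ∀ s → ∃[ t ] q (suc t) ≡ p (suc s)
  shrink p-inj eq p⊆q s with p⊆q (suc s)
  ... | suc t , e = t , e
  ... | zero  , e with () ← p-inj (trans eq e)

  go : ∀ s → p s ≡ q s
  go zero    = 0≡
  go (suc s) = monotone-unique (suc-injective ∘ p-inj) (suc-injective ∘ q-inj)
    (λ s≤t → p-mono (s≤s s≤t)) (λ s≤t → q-mono (s≤s s≤t))
    (shrink p-inj 0≡ p⊆q) (shrink q-inj (sym 0≡) q⊆p) s

-- The presheaf of faces of a cube

module _ {Act : Set} where

  open Hom

  ε-coface-≡ : ∀ {n} k (v : Vec Act (suc n)) i → ε (coface k v i) i ≡ at k
  ε-coface-≡ k v i with i ≟ i
  ... | yes _   = refl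
  ... | no  i≢i = contradiction refl i≢i

  ε-coface-≢ : ∀ {n} k (v : Vec Act (suc n)) {i u} → i ≢ u → ε (coface k v i) u ≡ *
  ε-coface-≢ k v {i} {u} i≢u with i ≟ u
  ... | yes i≡u = contradiction i≡u i≢u
  ... | no  _   = refl

  -- The faces of the cube on ls, that is, the morphisms into (N , ls).  Vectors
  -- and irrelevance make their propositional equality extensional.
  module _ {N : ℕ} (ls : Vec Act N) where

    record IsFace {n : ℕ} (axes : Vec (Fin N) n) (coords : Vec Coord N) : Set where
      field
        injective : Injective _≡_ _≡_ (lookup axes)
        monotone  : ∀ {s t} → s ≤ᶠ t → lookup axes s ≤ᶠ lookup axes t
        image     : ∀ u → lookup coords u ≡ * ⇔ (∃[ t ] lookup axes t ≡ u)

    record Face (U : Conclist Act) : Set where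
      constructor face
      field
        axes    : Vec (Fin N) (dim U)
        coords  : Vec Coord N
        labels  : map (lookup ls) axes ≡ proj₂ U
        .isFace : IsFace axes coords

  module _ {N : ℕ} {ls : Vec Act N} where

    open Face
    open IsFace using (image) renaming (injective to inj; monotone to mono)

    face-≡ : ∀ {U} {F G : Face ls U} → axes F ≡ axes G → coords F ≡ coords G → F ≡ G
    face-≡ {F = face a c l _} {face _ _ l′ q} refl refl =
      cong (λ l → face a c l q) (uip l l′)

    -- `isFace` is irrelevant, but equality on `Fin` is decidable, so `recompute` recovers a usable
    -- proof. The next three lemmas work in the same way.
    axes-injective : ∀ {U} (F : Face ls U) {s t} →
                     lookup (axes F) s ≡ lookup (axes F) t → s ≡ t
    axes-injective (face _ _ _ p) {s} {t} eq = recompute (s ≟ t) (inj p eq)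

    axes-monotone : ∀ {U} (F : Face ls U) {s t} → s ≤ᶠ t →
                    lookup (axes F) s ≤ᶠ lookup (axes F) t
    axes-monotone (face _ _ _ p) s≤t = recompute (_ ≤? _) (mono p s≤t)

    coords-axis : ∀ {U} (F : Face ls U) t → lookup (coords F) (lookup (axes F) t) ≡ *
    coords-axis (face _ _ _ p) t = recompute (star? _) (Equivalence.from (image p _) (t , refl))

    axis-of : ∀ {U} (F : Face ls U) {u} → lookup (coords F) u ≡ * →
              ∃[ t ] lookup (axes F) t ≡ u
    axis-of (face a _ _ p) {u} eq =
      recompute (any? (λ t → lookup a t ≟ u)) (Equivalence.to (image p _) eq)

    label-axis : ∀ {U} (F : Face ls U) t → label U t ≡ lookup ls (lookup (axes F) t)
    label-axis F t =
      trans (sym (cong (λ v → lookup v t) (labels F))) (lookup-map t (lookup ls) (axes F))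

    module _ {U V : Conclist Act} (F : Face ls V) (g : Hom U V) where

      private
        η : Fin N → Coord
        η u with any? (λ t → lookup (axes F) t ≟ u)
        ... | yes (t , _) = ε g t
        ... | no  _       = lookup (coords F) u

        η-∈ : ∀ t → η (lookup (axes F) t) ≡ ε g t
        η-∈ t with any? (λ s → lookup (axes F) s ≟ lookup (axes F) t)
        ... | yes (s , eq) = cong (ε g) (axes-injective F eq)
        ... | no  ∉        = contradiction (t , refl) ∉

        η-∉ : ∀ {u} → ¬ (∃[ t ] lookup (axes F) t ≡ u) → η u ≡ lookup (coords F) u
        η-∉ {u} ∉ with any? (λ s → lookup (axes F) s ≟ u)
        ... | yes ∈ = contradiction ∈ ∉
        ... | no  _ = refl

        axes′ : Vec (Fin N) (dim U)
        axes′ = tabulate (λ t → lookup (axes F) (f g t))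

        axes′-lookup : ∀ t → lookup axes′ t ≡ lookup (axes F) (f g t)
        axes′-lookup = lookup∘tabulate _

        coords′ : Vec Coord N
        coords′ = tabulate η

        to : ∀ {u} → η u ≡ * → ∃[ s ] lookup axes′ s ≡ u
        to {u} e with any? (λ t → lookup (axes F) t ≟ u)
        ... | no  ∉          = contradiction (axis-of F e) ∉
        ... | yes (t , refl) with Equivalence.to (Hom.image g t) e
        ...   | s , refl = s , axes′-lookup s

        from : ∀ {u} → (∃[ s ] lookup axes′ s ≡ u) → η u ≡ *
        from (s , refl) =
          trans (cong η (axes′-lookup s))
                (trans (η-∈ (f g s)) (Equivalence.from (Hom.image g _) (s , refl)))

      infixl 9 _·_
      -- The composite of `F`, read as a morphism into the cube, with `g`; `η` mirrors the
      -- coordinate rule of `_∘ₕ_`.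
      _·_ : Face ls U
      _·_ .axes   = axes′
      _·_ .coords = coords′
      _·_ .labels = lookup-ext λ t →
        trans (lookup-map t (lookup ls) axes′)
        (trans (cong (lookup ls) (axes′-lookup t))
        (trans (sym (label-axis F (f g t))) (labelled g t)))
      _·_ .isFace = record
        { injective = λ {s} {t} eq → injective g (axes-injective F
            (trans (sym (axes′-lookup s)) (trans eq (axes′-lookup t))))
        ; monotone  = λ {s} {t} s≤t →
            subst₂ _≤ᶠ_ (sym (axes′-lookup s)) (sym (axes′-lookup t))
                   (axes-monotone F (monotone g s≤t))
        ; image     = λ u → mk⇔ (λ e → to (trans (sym (lookup∘tabulate η u)) e))
                                (λ s → trans (lookup∘tabulate η u) (from s))
        }

      axes-· : ∀ t → lookup (axes _·_) t ≡ lookup (axes F) (f g t)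
      axes-· = axes′-lookup

      coords-·-∈ : ∀ t → lookup (coords _·_) (lookup (axes F) t) ≡ ε g t
      coords-·-∈ t = trans (lookup∘tabulate η _) (η-∈ t)

      coords-·-∉ : ∀ {u} → ¬ (∃[ t ] lookup (axes F) t ≡ u) →
                   lookup (coords _·_) u ≡ lookup (coords F) u
      coords-·-∉ ∉ = trans (lookup∘tabulate η _) (η-∉ ∉)

      coords-·-mono : ∀ u → lookup (coords F) u ≡ * ⊎
                            lookup (coords F) u ≡ lookup (coords _·_) u
      coords-·-mono u with any? (λ t → lookup (axes F) t ≟ u)
      ... | yes (t , refl) = inj₁ (coords-axis F t)
      ... | no  ∉          = inj₂ (sym (coords-·-∉ ∉))

    ·-ext : ∀ {U V} (F : Face ls V) {g : Hom U V} {G : Face ls U} →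
            (∀ t → lookup (axes F) (f g t) ≡ lookup (axes G) t) →
            (∀ t → ε g t ≡ lookup (coords G) (lookup (axes F) t)) →
            (∀ {u} → ¬ (∃[ t ] lookup (axes F) t ≡ u) → lookup (coords F) u ≡ lookup (coords G) u) →
            F · g ≡ G
    ·-ext F {g} {G} ax ∈ax ∉ax = face-≡
      (lookup-ext λ t → trans (axes-· F g t) (ax t))
      (lookup-ext coord)
      where
      coord : ∀ u → lookup (coords (F · g)) u ≡ lookup (coords G) u
      coord u with any? (λ t → lookup (axes F) t ≟ u)
      ... | yes (t , refl) = trans (coords-·-∈ F g t) (∈ax t)
      ... | no  ∉          = trans (coords-·-∉ F g ∉) (∉ax ∉)

    ·-resp : ∀ {U V} (F : Face ls V) {g h : Hom U V} → g ≈ h → F · g ≡ F · h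
    ·-resp F {g} {h} (f≡ , ε≡) = ·-ext F
      (λ t → trans (cong (lookup (axes F)) (f≡ t)) (sym (axes-· F h t)))
      (λ t → trans (ε≡ t) (sym (coords-·-∈ F h t)))
      (λ ∉ → sym (coords-·-∉ F h ∉))

    ·-id : ∀ {U} (F : Face ls U) → F · idₕ ≡ F
    ·-id F = ·-ext F (λ _ → refl) (λ t → sym (coords-axis F t)) (λ _ → refl)

    ·-∘ : ∀ {U V W} (F : Face ls W) (g : Hom V W) (h : Hom U V) → F · (g ∘ₕ h) ≡ F · g · h
    ·-∘ F g h = ·-ext F
      (λ t → sym (trans (axes-· (F · g) h t) (axes-· F g (f h t))))
      ∈ax
      (λ ∉ → sym (trans (coords-·-∉ (F · g) h λ (s , eq) →
                           ∉ (f g s , trans (sym (axes-· F g s)) eq))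
                        (coords-·-∉ F g ∉)))
      where
      ∈ax : ∀ t → ε (g ∘ₕ h) t ≡ lookup (coords (F · g · h)) (lookup (axes F) t)
      ∈ax t with any? (λ s → f g s ≟ t)
      ... | yes (s , refl) = sym (trans
              (cong (lookup (coords (F · g · h))) (sym (axes-· F g s)))
              (coords-·-∈ (F · g) h s))
      ... | no ∉ = sym (trans
              (coords-·-∉ (F · g) h λ (s , eq) →
                 ∉ (s , axes-injective F (trans (sym (axes-· F g s)) eq)))
              (coords-·-∈ F g t))

    coords-coface : ∀ {n} {v : Vec Act (suc n)} k (F : Face ls (suc n , v)) i →
                    coords (F · coface k v i) ≡ coords F [ lookup (axes F) i ]≔ at k
    coords-coface {v = v} k F i = lookup-ext go
      where
      G = F · coface k v i
      go : ∀ u → lookup (coords G) u ≡ lookup (coords F [ lookup (axes F) i ]≔ at k) u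
      go u with any? (λ t → lookup (axes F) t ≟ u)
      ... | no ∉ = trans (coords-·-∉ F _ ∉)
                         (sym (lookup∘update′ (λ eq → ∉ (i , sym eq)) (coords F) _))
      ... | yes (t , refl) with i ≟ t in e
      ...   | yes refl = trans (coords-·-∈ F _ i)
                           (trans (ε-coface-≡ k v i) (sym (lookup∘update (lookup (axes F) i) (coords F) _)))
      ...   | no i≢t = trans (coords-·-∈ F _ t) (trans (ε-coface-≢ k v i≢t)
                         (trans (sym (coords-axis F t))
                           (sym (lookup∘update′ (λ eq → i≢t (axes-injective F (sym eq))) (coords F) _))))

-- Faces determined by coordinates or by lower faces

module _ {Act : Set} {N : ℕ} {ls : Vec Act N} where

  open Face

  axes-unique : ∀ {n} {v v′ : Vec Act n} (F : Face ls (n , v)) (G : Face ls (n , v′)) →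
                coords F ≡ coords G → axes F ≡ axes G
  axes-unique F G eq = lookup-ext (monotone-unique {p = lookup (axes F)} {lookup (axes G)}
    (axes-injective F) (axes-injective G) (axes-monotone F) (axes-monotone G)
    (λ s → axis-of G (trans (sym (cong (λ c → lookup c (lookup (axes F) s)) eq)) (coords-axis F s)))
    (λ s → axis-of F (trans (cong (λ c → lookup c (lookup (axes G) s)) eq) (coords-axis G s))))

  -- The coordinates `*` mark the axes, monotonicity fixes their order, and the labels are then read
  -- off `ls`.
  face-unique : ∀ {n} {v v′ : Vec Act n} (F : Face ls (n , v)) (G : Face ls (n , v′)) →
                coords F ≡ coords G →
                _≡_ {A = ∃ λ v → Face ls (n , v)} (v , F) (v′ , G)
  face-unique F@(face _ _ refl _) G@(face _ _ refl _) refl with refl ← axes-unique F G refl = refl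

  δᶠ : Bit → ((U , F) : ∃ (Face ls)) → Fin (dim U) → ∃ (Face ls)
  δᶠ k ((suc n , v) , F) i = (n , removeAt v i) , F · coface k v i

  lower-face-coords : ∀ {c V V′} (F : Face ls V) (G : Face ls V′) i j →
    c ≡ δᶠ 0₂ (V , F) i → c ≡ δᶠ 0₂ (V′ , G) j →
    lookup (axes F) i ≡ lookup (axes G) j → coords F ≡ coords G
  lower-face-coords {V = suc _ , _} {suc _ , _} F G i j refl eq ax = lookup-ext go
    where
    open ≡-Reasoning
    a = lookup (axes F) i
    b = lookup (axes G) j

    go : ∀ u → lookup (coords F) u ≡ lookup (coords G) u
    go u with a ≟ u
    ... | yes refl = trans (coords-axis F i)
                       (sym (trans (cong (lookup (coords G)) ax) (coords-axis G j)))
    ... | no a≢u = begin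
      lookup (coords F) u                ≡⟨ lookup∘update′ (a≢u ∘ sym) (coords F) _ ⟨
      lookup (coords F [ a ]≔ at 0₂) u   ≡⟨ cong (λ c → lookup c u) (coords-coface 0₂ F i) ⟨
      lookup (coords (F · _)) u          ≡⟨ cong (λ c → lookup (coords (proj₂ c)) u) eq ⟩
      lookup (coords (G · _)) u          ≡⟨ cong (λ c → lookup c u) (coords-coface 0₂ G j) ⟩
      lookup (coords G [ b ]≔ at 0₂) u   ≡⟨ lookup∘update′ (λ e → a≢u (trans ax (sym e))) (coords G) _ ⟩
      lookup (coords G) u                ∎

  -- Off the axis of the started event the coordinates are those of the lower face, and on it the
  -- coordinate is `*`. So the source of an up-step and the event it starts determine its target.
  lower-face-unique : ∀ {c V V′} (F : Face ls V) (G : Face ls V′) i j →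
    c ≡ δᶠ 0₂ (V , F) i → c ≡ δᶠ 0₂ (V′ , G) j →
    lookup (axes F) i ≡ lookup (axes G) j →
    _≡_ {A = ∃ λ V → Face ls V × Fin (dim V)} (V , F , i) (V′ , G , j)
  lower-face-unique {V = suc n , v} {suc n′ , v′} F G i j p q ax
    with refl ← cong (dim ∘ proj₁) (trans (sym p) q)
    with refl ← face-unique F G (lower-face-coords F G i j p q ax)
    = cong (λ i → _ , F , i) (axes-injective F ax)

-- Kinds of faces and their data

-- The faces of the cube on (a , b , c), classified by the progress of a and b:
-- before if one of them has not started, after if both have ended, both and
-- both⁺ if both are running and c has not, respectively has, started.
data Kind : Set where
  before both both⁺ onlyB onlyA after : Kind

kind : Vec Coord 3 → Kind
kind (at 0₂ ∷ _     ∷ _         ∷ []) = before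
kind (*     ∷ at 0₂ ∷ _         ∷ []) = before
kind (at 1₂ ∷ at 0₂ ∷ _         ∷ []) = before
kind (*     ∷ *     ∷ at 0₂     ∷ []) = both
kind (*     ∷ *     ∷ at 1₂     ∷ []) = both⁺
kind (*     ∷ *     ∷ *         ∷ []) = both⁺
kind (at 1₂ ∷ *     ∷ _         ∷ []) = onlyB
kind (*     ∷ at 1₂ ∷ _         ∷ []) = onlyA
kind (at 1₂ ∷ at 1₂ ∷ _         ∷ []) = after

infix 4 _≼_
-- Contains each pair formed by the kind of a face and that of a cell it bounds, see `kind-mono`. It
-- is coarser at `before≼`, harmlessly, as `Datum before` is a unit type.
data _≼_ : Kind → Kind → Set where
  ≼-refl      : ∀ {k} → k ≼ k
  before≼     : ∀ {k} → before ≼ k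
  after≼onlyB : after ≼ onlyB
  after≼onlyA : after ≼ onlyA
  after≼both  : after ≼ both
  after≼both⁺ : after ≼ both⁺
  onlyB≼both  : onlyB ≼ both
  onlyB≼both⁺ : onlyB ≼ both⁺
  onlyA≼both  : onlyA ≼ both
  onlyA≼both⁺ : onlyA ≼ both⁺
  both≼both⁺  : both ≼ both⁺

infix 4 _≽_
data _≽_ : Coord → Coord → Set where
  *≽*   : * ≽ *
  *≽at  : ∀ {k} → * ≽ at k
  at≽at : ∀ {k} → at k ≽ at k

≽-intro : ∀ {x y} → x ≡ * ⊎ x ≡ y → x ≽ y
≽-intro {y = *}    (inj₁ refl) = *≽*
≽-intro {y = at _} (inj₁ refl) = *≽at
≽-intro {y = *}    (inj₂ refl) = *≽*
≽-intro {y = at _} (inj₂ refl) = at≽at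

kind-mono : ∀ v w → (∀ i → lookup v i ≽ lookup w i) → kind w ≼ kind v
kind-mono (A ∷ B ∷ C ∷ []) (A′ ∷ B′ ∷ C′ ∷ []) v≽w =
  go (v≽w zero) (v≽w (suc zero)) (v≽w (suc (suc zero)))
  where
  go : ∀ {A B C A′ B′ C′} → A ≽ A′ → B ≽ B′ → C ≽ C′ →
       kind (A′ ∷ B′ ∷ C′ ∷ []) ≼ kind (A ∷ B ∷ C ∷ [])
  go {A′ = at 0₂}             _ _ _ = before≼
  go {A′ = *}     {B′ = at 0₂} _ _ _ = before≼
  go {A′ = at 1₂} {B′ = at 0₂} _ _ _ = before≼
  go *≽*          *≽*          *≽*          = ≼-refl
  go *≽*          *≽*          (*≽at {0₂})  = both≼both⁺
  go *≽*          *≽*          (*≽at {1₂})  = ≼-refl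
  go *≽*          *≽*          at≽at        = ≼-refl
  go (at≽at {1₂}) *≽*          _            = ≼-refl
  go (*≽at {1₂})  *≽*          *≽*          = onlyB≼both⁺
  go (*≽at {1₂})  *≽*          *≽at         = onlyB≼both⁺
  go (*≽at {1₂})  *≽*          (at≽at {0₂}) = onlyB≼both
  go (*≽at {1₂})  *≽*          (at≽at {1₂}) = onlyB≼both⁺
  go *≽*          (at≽at {1₂}) _            = ≼-refl
  go *≽*          (*≽at {1₂})  *≽*          = onlyA≼both⁺
  go *≽*          (*≽at {1₂})  *≽at         = onlyA≼both⁺
  go *≽*          (*≽at {1₂})  (at≽at {0₂}) = onlyA≼both
  go *≽*          (*≽at {1₂})  (at≽at {1₂}) = onlyA≼both⁺
  go (at≽at {1₂}) (at≽at {1₂}) _            = ≼-refl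
  go (at≽at {1₂}) (*≽at {1₂})  _            = after≼onlyB
  go (*≽at {1₂})  (at≽at {1₂}) _            = after≼onlyA
  go (*≽at {1₂})  (*≽at {1₂})  *≽*          = after≼both⁺
  go (*≽at {1₂})  (*≽at {1₂})  *≽at         = after≼both⁺
  go (*≽at {1₂})  (*≽at {1₂})  (at≽at {0₂}) = after≼both
  go (*≽at {1₂})  (*≽at {1₂})  (at≽at {1₂}) = after≼both⁺

-- onlyB x and onlyA x are two copies of each edge; just x is the square below
-- the cube x, and nothing is a square that bounds no cube.
Datum : Kind → Set
Datum before = ⊤
Datum both   = Maybe Bool
Datum both⁺  = Bool
Datum onlyB  = Bool
Datum onlyA  = Bool
Datum after  = ⊤

-- The last four clauses are junk: they concern kinds with no face relation.
restrict : (Bool → Bool) → ∀ k k′ → Datum k → Datum k′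
restrict σ both  both  d        = d
restrict σ both  onlyB nothing  = true
restrict σ both  onlyB (just x) = x
restrict σ both  onlyA nothing  = true
restrict σ both  onlyA (just x) = σ x
restrict σ both⁺ both⁺ x        = x
restrict σ both⁺ both  x        = just x
restrict σ both⁺ onlyB x        = x
restrict σ both⁺ onlyA x        = σ x
restrict σ onlyB onlyB x        = x
restrict σ onlyA onlyA x        = x
restrict σ _     before _       = tt
restrict σ _     after  _       = tt
restrict σ _     both   _       = nothing
restrict σ _     both⁺  _       = true
restrict σ _     onlyB  _       = true
restrict σ _     onlyA  _       = true

module _ {σ : Bool → Bool} where

  restrict-id : ∀ {k} (d : Datum k) → restrict σ k k d ≡ d
  restrict-id {before} _ = refl
  restrict-id {both}   _ = refl
  restrict-id {both⁺}  _ = refl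
  restrict-id {onlyB}  _ = refl
  restrict-id {onlyA}  _ = refl
  restrict-id {after}  _ = refl

  -- The twist is applied on the way to `onlyA` from `both⁺` as well as from `both`, but not from
  -- `both⁺` to `both`; hence the two ways from a cube to an edge agree.
  restrict-∘ : ∀ {k k′ k″} → k″ ≼ k′ → k′ ≼ k → (d : Datum k) →
               restrict σ k k″ d ≡ restrict σ k′ k″ (restrict σ k k′ d)
  restrict-∘ ≼-refl  q d = sym (restrict-id _)
  restrict-∘ before≼ q d = refl
  restrict-∘ {k″ = k″} p ≼-refl d = cong (restrict σ _ k″) (sym (restrict-id d))
  restrict-∘ after≼onlyB q d = refl
  restrict-∘ after≼onlyA q d = refl
  restrict-∘ after≼both  q d = refl
  restrict-∘ onlyB≼both  both≼both⁺ d = refl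
  restrict-∘ onlyA≼both  both≼both⁺ d = refl

-- The kinds of a lower face and of the cell it bounds.
data Up : Kind → Kind → Set where
  before  : ∀ {k} → Up before k
  thicken : Up both both⁺
  onlyB   : Up onlyB onlyB
  onlyA   : Up onlyA onlyA
  after   : Up after after

kind-up : ∀ v i → lookup v i ≡ * → Up (kind (v [ i ]≔ at 0₂)) (kind v)
kind-up (_     ∷ _     ∷ _ ∷ []) zero             _ = before
kind-up (*     ∷ _     ∷ _ ∷ []) (suc zero)       _ = before
kind-up (at 0₂ ∷ _     ∷ _ ∷ []) (suc zero)       _ = before
kind-up (at 1₂ ∷ _     ∷ _ ∷ []) (suc zero)       _ = before
kind-up (at 0₂ ∷ _     ∷ _ ∷ []) (suc (suc zero)) _ = before
kind-up (*     ∷ at 0₂ ∷ _ ∷ []) (suc (suc zero)) _ = before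
kind-up (at 1₂ ∷ at 0₂ ∷ _ ∷ []) (suc (suc zero)) _ = before
kind-up (*     ∷ *     ∷ * ∷ []) (suc (suc zero)) _ = thicken
kind-up (at 1₂ ∷ *     ∷ _ ∷ []) (suc (suc zero)) _ = onlyB
kind-up (*     ∷ at 1₂ ∷ _ ∷ []) (suc (suc zero)) _ = onlyA
kind-up (at 1₂ ∷ at 1₂ ∷ _ ∷ []) (suc (suc zero)) _ = after

-- The kinds of a cell and of its upper face.
data Down : Kind → Kind → Set where
  before      : Down before before
  both⁺       : Down both⁺ both⁺
  both-onlyB  : Down both onlyB
  both-onlyA  : Down both onlyA
  both⁺-onlyB : Down both⁺ onlyB
  both⁺-onlyA : Down both⁺ onlyA
  onlyB       : Down onlyB onlyB
  onlyB-after : Down onlyB after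
  onlyA       : Down onlyA onlyA
  onlyA-after : Down onlyA after
  after       : Down after after

kind-down : ∀ v i → lookup v i ≡ * → Down (kind v) (kind (v [ i ]≔ at 1₂))
kind-down (*     ∷ at 0₂ ∷ _     ∷ []) zero             _ = before
kind-down (*     ∷ *     ∷ at 0₂ ∷ []) zero             _ = both-onlyB
kind-down (*     ∷ *     ∷ at 1₂ ∷ []) zero             _ = both⁺-onlyB
kind-down (*     ∷ *     ∷ *     ∷ []) zero             _ = both⁺-onlyB
kind-down (*     ∷ at 1₂ ∷ _     ∷ []) zero             _ = onlyA-after
kind-down (at 0₂ ∷ *     ∷ _     ∷ []) (suc zero)       _ = before
kind-down (*     ∷ *     ∷ at 0₂ ∷ []) (suc zero)       _ = both-onlyA
kind-down (*     ∷ *     ∷ at 1₂ ∷ []) (suc zero)       _ = both⁺-onlyA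
kind-down (*     ∷ *     ∷ *     ∷ []) (suc zero)       _ = both⁺-onlyA
kind-down (at 1₂ ∷ *     ∷ _     ∷ []) (suc zero)       _ = onlyB-after
kind-down (at 0₂ ∷ _     ∷ _     ∷ []) (suc (suc zero)) _ = before
kind-down (*     ∷ at 0₂ ∷ _     ∷ []) (suc (suc zero)) _ = before
kind-down (at 1₂ ∷ at 0₂ ∷ _     ∷ []) (suc (suc zero)) _ = before
kind-down (*     ∷ *     ∷ *     ∷ []) (suc (suc zero)) _ = both⁺
kind-down (*     ∷ *     ∷ at _  ∷ []) (suc (suc zero)) ()
kind-down (at 1₂ ∷ *     ∷ _     ∷ []) (suc (suc zero)) _ = onlyB
kind-down (*     ∷ at 1₂ ∷ _     ∷ []) (suc (suc zero)) _ = onlyA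
kind-down (at 1₂ ∷ at 1₂ ∷ _     ∷ []) (suc (suc zero)) _ = after

Up⇒≼ : ∀ {k k′} → Up k k′ → k ≼ k′
Up⇒≼ before  = before≼
Up⇒≼ thicken = both≼both⁺
Up⇒≼ onlyB   = ≼-refl
Up⇒≼ onlyA   = ≼-refl
Up⇒≼ after   = ≼-refl

Down⇒≼ : ∀ {k k′} → Down k k′ → k′ ≼ k
Down⇒≼ before      = ≼-refl
Down⇒≼ both⁺       = ≼-refl
Down⇒≼ both-onlyB  = onlyB≼both
Down⇒≼ both-onlyA  = onlyA≼both
Down⇒≼ both⁺-onlyB = onlyB≼both⁺
Down⇒≼ both⁺-onlyA = onlyA≼both⁺
Down⇒≼ onlyB       = ≼-refl
Down⇒≼ onlyB-after = after≼onlyB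
Down⇒≼ onlyA       = ≼-refl
Down⇒≼ onlyA-after = after≼onlyA
Down⇒≼ after       = ≼-refl

-- Matching data across single steps and squares of steps

-- What related paths have in common at the cells at which they leave the kind
-- before.
info : ∀ k → Datum k → Bool
info before _ = true
info both   d = is-just d
info both⁺  _ = true
info onlyB  x = x
info onlyA  x = x
info after  _ = true

Comparison : Set₁
Comparison = (k k′ : Kind) → Datum k′ → Datum k′ → Set

-- Only steps that start in `before` are constrained; data met later may differ.
Agree : Comparison
Agree k k′ d e = k ≡ Kind.before → info k′ d ≡ info k′ e

module _ {σ τ : Bool → Bool} where

  -- Out of `before` the datum `d′` itself can be copied. Only `thicken` could fail, since `nothing`
  -- bounds no cube, and the hypothesis on `info` excludes this.
  up-follow : ∀ {k k′} → Up k k′ → ∀ d′ e →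
              (k ≡ Kind.both → info k (restrict σ k′ k d′) ≡ info k e) →
              ∃[ e′ ] e ≡ restrict τ k′ k e′ × Agree k k′ d′ e′
  up-follow before d′ tt _ = d′ , refl , λ _ → refl
  up-follow thicken _ (just x) _ = x , refl , λ ()
  up-follow thicken _ nothing  ok with () ← ok refl
  up-follow onlyB   _ x _ = x , refl , λ ()
  up-follow onlyA   _ x _ = x , refl , λ ()
  up-follow after   _ x _ = x , refl , λ ()

  -- The route down from `k` to `l` and up to `n` is to be replaced by one up to `m` and down to
  -- `n`. Given the datum `d` of `m` on one side, a datum `e` on the other side must bound both `x`
  -- and `z`, and agree with `d`.
  fill : (∀ x → τ (τ x) ≡ x) → ∀ {k l m n} → Up k m → Down m n → Down k l → Up l n →
         ∀ (d : Datum m) (x : Datum k) (z : Datum n) →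
         restrict τ k l x ≡ restrict τ n l z →
         (k ≡ Kind.both → info k (restrict σ m k d) ≡ info k x) →
         Agree l n (restrict σ m n d) z →
         ∃[ e ] x ≡ restrict τ m k e × z ≡ restrict τ m n e ×
                Agree k m d e × Agree m n (restrict σ m n d) z
  fill ττ before before      before before d tt z _ _ ok = d , refl , refl , (λ _ → refl) , ok
  fill ττ before both⁺       before before d tt z _ _ ok = z , refl , refl , (λ _ → refl) , λ ()
  -- The square `nothing` must be answered by `nothing`, whose edges are `true`; `ok` makes `z`
  -- equal to `true`.
  fill ττ before both-onlyB  before before nothing  tt z _ _ ok =
    nothing , refl , sym (ok refl) , (λ _ → refl) , λ ()
  fill ττ before both-onlyB  before before (just x) tt z _ _ ok =
    just z , refl , refl , (λ _ → refl) , λ ()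
  fill ττ before both-onlyA  before before nothing  tt z _ _ ok =
    nothing , refl , sym (ok refl) , (λ _ → refl) , λ ()
  -- As `τ` is an involution, the square `just (τ z)` has the edge `z`.
  fill ττ before both-onlyA  before before (just x) tt z _ _ ok =
    just (τ z) , refl , sym (ττ z) , (λ _ → refl) , λ ()
  fill ττ before both⁺-onlyB before before d tt z _ _ ok = z , refl , refl , (λ _ → refl) , λ ()
  fill ττ before both⁺-onlyA before before d tt z _ _ ok =
    τ z , refl , sym (ττ z) , (λ _ → refl) , λ ()
  fill ττ before onlyB       before before d tt z _ _ ok = z , refl , refl , (λ _ → ok refl) , λ ()
  fill ττ before onlyB-after before before d tt z _ _ ok = d , refl , refl , (λ _ → refl) , λ ()
  fill ττ before onlyA       before before d tt z _ _ ok = z , refl , refl , (λ _ → ok refl) , λ ()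
  fill ττ before onlyA-after before before d tt z _ _ ok = d , refl , refl , (λ _ → refl) , λ ()
  fill ττ before after       before before d tt z _ _ ok = d , refl , refl , (λ _ → refl) , λ ()
  fill ττ thicken both⁺-onlyB both-onlyB onlyB d (just x) z eq _ ok =
    x , refl , sym eq , (λ ()) , λ ()
  fill ττ thicken both⁺-onlyA both-onlyA onlyA d (just x) z eq _ ok =
    x , refl , sym eq , (λ ()) , λ ()
  fill ττ thicken both⁺ both-onlyB ()
  fill ττ thicken both⁺ both-onlyA ()
  -- On the other side the square lies under the cube `d`, so `inf` rules out `nothing`.
  fill ττ thicken _ _ _ d nothing z eq inf ok with () ← inf refl
  fill ττ onlyB onlyB       onlyB       onlyB d x z eq _ ok = x , refl , sym eq , (λ ()) , λ ()
  fill ττ onlyB onlyB-after onlyB-after after d x z eq _ ok = x , refl , refl , (λ ()) , λ ()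
  fill ττ onlyA onlyA       onlyA       onlyA d x z eq _ ok = x , refl , sym eq , (λ ()) , λ ()
  fill ττ onlyA onlyA-after onlyA-after after d x z eq _ ok = x , refl , refl , (λ ()) , λ ()
  fill ττ after after after after d x z eq _ ok = x , refl , refl , (λ ()) , λ ()

module _ {σ τ : Bool → Bool} where

  up-info⁺ : ∀ {k k′} → Up k k′ → ∀ d e →
             info k (restrict σ k′ k d) ≡ info k (restrict τ k′ k e) →
             Agree k k′ d e → info k′ d ≡ info k′ e
  up-info⁺ before  _ _ _  ok = ok refl
  up-info⁺ thicken _ _ _  _  = refl
  up-info⁺ onlyB   _ _ eq _  = eq
  up-info⁺ onlyA   _ _ eq _  = eq
  up-info⁺ after   _ _ _  _  = refl

  up-info⁻ : ∀ {k k′} → Up k k′ → ∀ d e → info k′ d ≡ info k′ e →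
             info k (restrict σ k′ k d) ≡ info k (restrict τ k′ k e)
  up-info⁻ before  _ _ _  = refl
  up-info⁻ thicken _ _ _  = refl
  up-info⁻ onlyB   _ _ eq = eq
  up-info⁻ onlyA   _ _ eq = eq
  up-info⁻ after   _ _ _  = refl

  -- From `before`, agreement passes up to the top cell along one pair of steps by `up-info⁺`, and
  -- back down to `m` along the other by `up-info⁻`. From other kinds nothing is compared.
  swap-agree : ∀ {k l m n} → Up k l → Up l n → Up k m → Up m n → ∀ d e →
               Agree k l (restrict σ n l d) (restrict τ n l e) → Agree l n d e →
               Agree k m (restrict σ n m d) (restrict τ n m e) × Agree m n d e
  swap-agree before kl km mn d e ok ok′ = (λ _ → up-info⁻ mn d e eq) , λ _ → eq
    where eq = up-info⁺ kl d e (ok refl) ok′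
  swap-agree thicken _ thicken _ _ _ _ _ = (λ ()) , λ ()
  swap-agree onlyB   _ onlyB   _ _ _ _ _ = (λ ()) , λ ()
  swap-agree onlyA   _ onlyA   _ _ _ _ _ = (λ ()) , λ ()
  swap-agree after   _ after   _ _ _ _ _ = (λ ()) , λ ()

-- A down-step from `before` stays in `before`, where `info` is constant.
down-agree : ∀ {k k′} → Down k k′ → ∀ d e → Agree k k′ d e
down-agree before _ _ _ = refl

up-into-both : ∀ {k k′} → Up k k′ → k′ ≡ both → k ≡ before
up-into-both before _ = refl

down-into-both : ∀ {k k′} → Down k k′ → k′ ≢ both
down-into-both () refl

-- The twisted HDAs

module _ {Act : Set} (ls : Vec Act 3) where

  open Face

  kindOf : ∀ {U} → Face ls U → Kind
  kindOf F = kind (coords F)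

  ·-≼ : ∀ {U V} (F : Face ls V) (g : Hom U V) → kindOf (F · g) ≼ kindOf F
  ·-≼ F g = kind-mono (coords F) (coords (F · g)) (≽-intro ∘ coords-·-mono F g)

  origin : Face ls (0 , [])
  origin = face [] (replicate 3 (at 0₂)) refl record
    { injective = λ { {()} }
    ; monotone  = λ { {()} }
    ; image     = λ u → mk⇔ (λ e → contradiction (trans (sym (lookup-replicate u (at 0₂))) e) λ ())
                            (λ ())
    }

  cells : (Bool → Bool) → Precubical Act
  cells σ .Precubical._[_] U = ∃ λ (F : Face ls U) → Datum (kindOf F)
  cells σ .Precubical.⟪_⟫ g (F , d) = F · g , restrict σ _ _ d
  cells σ .Precubical.resp-≈ g≈h (F , d) = cong (λ G → G , restrict σ _ _ d) (·-resp F g≈h)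
  cells σ .Precubical.identity (F , d) =
    trans (cong (λ G → G , restrict σ _ _ d) (·-id F)) (cong (F ,_) (restrict-id d))
  cells σ .Precubical.homomorphism g h (F , d) =
    trans (cong (λ G → G , restrict σ _ _ d) (·-∘ F g h))
          (cong (F · g · h ,_) (restrict-∘ (·-≼ (F · g) h) (·-≼ F g) d))

  Twisted : (Bool → Bool) → HDA Act
  Twisted σ .HDA.precubical = cells σ
  Twisted σ .HDA.initial    = origin , tt

  module _ {σ : Bool → Bool} where

    δ-up : ∀ {U V F G d e i} → (U , F , d) ≡ δ (Twisted σ) 0₂ (V , G , e) i → Up (kindOf F) (kindOf G)
    δ-up {V = suc _ , _} {G = G} {i = i} refl =
      subst (λ c → Up (kind c) (kindOf G)) (sym (coords-coface 0₂ G i))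
            (kind-up (coords G) _ (coords-axis G i))

    δ-down : ∀ {U V F G d e i} → (U , F , d) ≡ δ (Twisted σ) 1₂ (V , G , e) i → Down (kindOf G) (kindOf F)
    δ-down {V = suc _ , _} {G = G} {i = i} refl =
      subst (λ c → Down (kindOf G) (kind c)) (sym (coords-coface 1₂ G i))
            (kind-down (coords G) _ (coords-axis G i))

    δ-datum : ∀ {U V F G d e k i} → (U , F , d) ≡ δ (Twisted σ) k (V , G , e) i →
              d ≡ restrict σ (kindOf G) (kindOf F) e
    δ-datum {V = suc _ , _} refl = refl

    -- The twist enters through the data only, so a face relation can be carried to another twist
    -- once the data fit.
    δ-with : ∀ {τ U V F G d e k i} {d′ e′} → (U , F , d) ≡ δ (Twisted σ) k (V , G , e) i →
             d′ ≡ restrict τ (kindOf G) (kindOf F) e′ → (U , F , d′) ≡ δ (Twisted τ) k (V , G , e′) i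
    δ-with {V = suc _ , _} refl refl = refl

-- Runs over the same faces

module _ {Act : Set} {ls : Vec Act 3} where

  open Face

  module _ {σ τ : Bool → Bool} where

    data Lift {U V} {F : Face ls U} {G : Face ls V} {d d′ e e′} :
      Step (Twisted ls σ) (U , F , d) (V , G , e) → Step (Twisted ls τ) (U , F , d′) (V , G , e′) → Set where
      up   : ∀ {i p q} → Lift (up i p) (up i q)
      down : ∀ {i p q} → Lift (down i p) (down i q)

    -- The two runs visit the same faces, and C relates their data after each step
    -- from a given kind.
    data Over (C : Comparison) : ∀ {U} {F : Face ls U} {d d′} →
      Run (Twisted ls σ) (U , F , d) → Run (Twisted ls τ) (U , F , d′) → Set where
      init   : Over C init init
      extend : ∀ {U V} {F : Face ls U} {G : Face ls V} {d d′ e e′}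
               {α : Run (Twisted ls σ) (U , F , d)} {β : Run (Twisted ls τ) (U , F , d′)}
               {s : Step (Twisted ls σ) (U , F , d) (V , G , e)}
               {t : Step (Twisted ls τ) (U , F , d′) (V , G , e′)} →
               Over C α β → Lift s t → C (kindOf ls F) (kindOf ls G) e e′ →
               Over C (α ▷ s) (β ▷ t)

    module _ {C : Comparison} where

      over-length : ∀ {U} {F : Face ls U} {d d′}
                      {α : Run (Twisted ls σ) (U , F , d)} {β : Run (Twisted ls τ) (U , F , d′)} →
                    Over C α β → length α ≡ length β
      over-length init           = refl
      over-length (extend o _ _) = cong suc (over-length o)

      -- `start` is computed from indices and lengths, which the two runs share.
      over-start : ∀ {U} {F : Face ls U} {d d′}
                     {α : Run (Twisted ls σ) (U , F , d)} {β : Run (Twisted ls τ) (U , F , d′)} →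
                   Over C α β → ∀ m → Defs.start α m ≡ Defs.start β m
      over-start init ()
      over-start (extend {V = suc _ , _} o (up {i} {refl} {refl}) _) m with i ≟ m
      ... | yes _ = cong suc (over-length o)
      ... | no  _ = over-start o _
      over-start (extend {U = suc _ , _} o (down {i} {refl} {refl}) _) m = over-start o _

      over-trace : ∀ {U} {F : Face ls U} {d d′}
                     {α : Run (Twisted ls σ) (U , F , d)} {β : Run (Twisted ls τ) (U , F , d′)} →
                   Over C α β → traceOf α ≡ traceOf β
      over-trace init = refl
      over-trace (extend o up _) = cong (_∷ʳ _) (over-trace o)
      over-trace (extend {U = U} o (down {i}) _) =
        cong₂ _∷ʳ_ (over-trace o) (cong (label U i ^_) (over-start o i))

    -- The kind `both` can only be entered by an up-step out of `before`, where `Agree` compares the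
    -- data.
    over-both : ∀ {U} {F : Face ls U} {d d′}
                  {α : Run (Twisted ls σ) (U , F , d)} {β : Run (Twisted ls τ) (U , F , d′)} →
                Over Agree α β → kindOf ls F ≡ both → info (kindOf ls F) d ≡ info (kindOf ls F) d′
    over-both init ()
    over-both (extend _ (up {p = p}) ok)   eq = ok (up-into-both (δ-up ls p) eq)
    over-both (extend _ (down {p = p}) _) eq = contradiction eq (down-into-both (δ-down ls p))

  over-sym : ∀ {σ τ U} {F : Face ls U} {d d′}
               {α : Run (Twisted ls σ) (U , F , d)} {β : Run (Twisted ls τ) (U , F , d′)} →
             Over Agree α β → Over Agree β α
  over-sym init               = init
  over-sym (extend o up   ok) = extend (over-sym o) up   (sym ∘ ok)
  over-sym (extend o down ok) = extend (over-sym o) down (sym ∘ ok)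

-- Transfer of replacements between related paths

module _ {Act : Set} where

  flipᴿ : ∀ {X : HDA Act} → Replacement {X = X} → Replacement {X = X}
  flipᴿ P s t s′ t′ = P s′ t′ s t

  module _ {X : HDA Act} {P : Replacement {X = X}} where

    replace-length : ∀ {ℓ α β} → Replace P ℓ α β → length (proj₂ α) ≡ length (proj₂ β)
    replace-length (here _)    = refl
    replace-length (later _ r) = cong suc (replace-length r)

    replace-end : ∀ {ℓ α β} → Replace P ℓ α β → proj₁ α ≡ proj₁ β
    replace-end (here _)    = refl
    replace-end (later _ _) = refl

    replace-flip : ∀ {ℓ α β} → Replace P ℓ α β → Replace (flipᴿ P) ℓ β α
    replace-flip (here p)    = here p
    replace-flip (later s r) = later s (replace-flip r)

    replace-unflip : ∀ {ℓ α β} → Replace (flipᴿ P) ℓ α β → Replace P ℓ β α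
    replace-unflip (here p)    = here p
    replace-unflip (later s r) = later s (replace-unflip r)

module _ {Act : Set} {ls : Vec Act 3} {σ τ : Bool → Bool} where

  data Related (C : Comparison) : REL (Path (Twisted ls σ)) (Path (Twisted ls τ)) 0ℓ where
    rel : ∀ {U} {F : Face ls U} {d d′}
            {α : Run (Twisted ls σ) (U , F , d)} {β : Run (Twisted ls τ) (U , F , d′)} →
          Over C α β → Related C (_ , α) (_ , β)

  -- Only the middle cell of the answer is free. The outer cells stay, so that the remaining steps
  -- of both paths can be put back.
  Follows : Replacement {X = Twisted ls σ} → Replacement {X = Twisted ls τ} → Set
  Follows P Q = ∀ {x y y′ z} {x₂ y₂ z₂} {α : Run (Twisted ls σ) x} {β : Run (Twisted ls τ) x₂}
    {s : Step (Twisted ls σ) x y} {t : Step (Twisted ls σ) y z}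
    {s′ : Step (Twisted ls σ) x y′} {t′ : Step (Twisted ls σ) y′ z}
    {s₂ : Step (Twisted ls τ) x₂ y₂} {t₂ : Step (Twisted ls τ) y₂ z₂} →
    Related Agree (_ , α ▷ s ▷ t) (_ , β ▷ s₂ ▷ t₂) → P s t s′ t′ →
    ∃[ y₂′ ] ∃₂ λ (s₂′ : Step (Twisted ls τ) x₂ y₂′) (t₂′ : Step (Twisted ls τ) y₂′ z₂) →
      Q s₂ t₂ s₂′ t₂′ × Related Agree (_ , α ▷ s′ ▷ t′) (_ , β ▷ s₂′ ▷ t₂′)

  module _ {P : Replacement {X = Twisted ls σ}} {Q : Replacement {X = Twisted ls τ}}
           (PQ : Follows P Q) where

    replace-run : ∀ {ℓ c c₂} {α α′ : Run (Twisted ls σ) c} {β : Run (Twisted ls τ) c₂} →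
                  Related Agree (c , α) (c₂ , β) →
                  Replace P ℓ (c , α) (c , α′) →
                  ∃ λ β′ → Replace Q ℓ (c₂ , β) (c₂ , β′) × Related Agree (c , α′) (c₂ , β′)
    replace-run {ℓ} r@(rel (extend (extend o a _) b _)) (here p) with PQ r p
    ... | _ , _ , _ , q , r′ =
      -- The position is computed from the length of the first run, which equals that of the second.
      _ , subst (λ n → Replace Q (suc n) _ _) (sym (over-length o)) (here q) , r′
    replace-run (rel (extend o a ok)) (later s ρ) with replace-run (rel o) ρ
    ... | _ , ρ′ , rel o′ = _ , later _ ρ′ , rel (extend o′ a ok)

    replace-follow : ∀ {ℓ α α′ β} → Related Agree α β → Replace P ℓ α α′ →
                     ∃[ β′ ] Replace Q ℓ β β′ × Related Agree α′ β′
    replace-follow r ρ with refl ← replace-end ρ with replace-run r ρ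
    ... | _ , ρ′ , r′ = _ , ρ′ , r′

module _ {Act : Set} {ls : Vec Act 3} {σ τ : Bool → Bool} where

  -- The new middle datum is restricted from the top cell; by functoriality its lower face is the
  -- given one.
  up-swap : ∀ {k l m n} → Up k l → Up l n → Up k m → Up m n →
            ∀ {l₁ m₁ n₁ k₂ l₂ n₂} →
            l₁ ≡ restrict σ n l n₁ → m₁ ≡ restrict σ n m n₁ →
            k₂ ≡ restrict τ l k l₂ → l₂ ≡ restrict τ n l n₂ →
            Agree k l l₁ l₂ → Agree l n n₁ n₂ →
            ∃[ m₂ ] k₂ ≡ restrict τ m k m₂ × m₂ ≡ restrict τ n m n₂ ×
                    Agree k m m₁ m₂ × Agree m n n₁ n₂
  up-swap kl ln km mn refl refl refl refl ok ok′ =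
    _ , trans (sym (restrict-∘ (Up⇒≼ kl) (Up⇒≼ ln) _)) (restrict-∘ (Up⇒≼ km) (Up⇒≼ mn) _) , refl ,
    swap-agree kl ln km mn _ _ ok ok′

  -- Here the new middle datum is restricted from the source.
  down-swap : ∀ {k l m n} → Down k l → Down l n → Down k m → Down m n →
              ∀ {m₁ n₁ k₂ l₂ n₂} →
              l₂ ≡ restrict τ k l k₂ → n₂ ≡ restrict τ l n l₂ →
              ∃[ m₂ ] m₂ ≡ restrict τ k m k₂ × n₂ ≡ restrict τ m n m₂ ×
                      Agree k m m₁ m₂ × Agree m n n₁ n₂
  down-swap kl ln km mn refl refl =
    _ , refl , trans (sym (restrict-∘ (Down⇒≼ ln) (Down⇒≼ kl) _)) (restrict-∘ (Down⇒≼ mn) (Down⇒≼ km) _) ,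
    down-agree km _ _ , down-agree mn _ _

  swap-follow : Follows (Swap {X = Twisted ls σ}) (Swap {X = Twisted ls τ})
  swap-follow (rel (extend (extend o (up {q = p₂}) ok) (up {q = q₂}) ok′))
              (up-up {p = p} {q} {p′} {q′} a b c)
    with up-swap (δ-up ls p) (δ-up ls q) (δ-up ls p′) (δ-up ls q′)
           (δ-datum ls q) (δ-datum ls q′) (δ-datum ls p₂) (δ-datum ls q₂) ok ok′
  ... | _ , e , e′ , ok₁ , ok₂ =
    _ , up _ (δ-with ls p′ e) , up _ (δ-with ls q′ e′) , up-up a b c ,
    rel (extend (extend o up ok₁) up ok₂)
  swap-follow (rel (extend (extend o (down {q = p₂}) ok) (down {q = q₂}) ok′))
              (down-down {p = p} {q} {p′} {q′} a b c)
    with down-swap (δ-down ls p) (δ-down ls q) (δ-down ls p′) (δ-down ls q′)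
           (δ-datum ls p₂) (δ-datum ls q₂)
  ... | _ , e , e′ , ok₁ , ok₂ =
    _ , down _ (δ-with ls p′ e) , down _ (δ-with ls q′ e′) , down-down a b c ,
    rel (extend (extend o down ok₁) down ok₂)

  unswap-follow : Follows (flipᴿ (Swap {X = Twisted ls σ})) (flipᴿ (Swap {X = Twisted ls τ}))
  unswap-follow (rel (extend (extend o (up {q = p₂}) ok) (up {q = q₂}) ok′))
                (up-up {p = p′} {q′} {p} {q} a b c)
    with up-swap (δ-up ls p) (δ-up ls q) (δ-up ls p′) (δ-up ls q′)
           (δ-datum ls q) (δ-datum ls q′) (δ-datum ls p₂) (δ-datum ls q₂) ok ok′
  ... | _ , e , e′ , ok₁ , ok₂ =
    _ , up _ (δ-with ls p′ e) , up _ (δ-with ls q′ e′) , up-up a b c ,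
    rel (extend (extend o up ok₁) up ok₂)
  unswap-follow (rel (extend (extend o (down {q = p₂}) ok) (down {q = q₂}) ok′))
                (down-down {p = p′} {q′} {p} {q} a b c)
    with down-swap (δ-down ls p) (δ-down ls q) (δ-down ls p′) (δ-down ls q′)
           (δ-datum ls p₂) (δ-datum ls q₂)
  ... | _ , e , e′ , ok₁ , ok₂ =
    _ , down _ (δ-with ls p′ e) , down _ (δ-with ls q′ e′) , down-down a b c ,
    rel (extend (extend o down ok₁) down ok₂)

-- The qhp-bisimulation

module _ {Act : Set} {ls : Vec Act 3} {σ τ : Bool → Bool} (ττ : ∀ x → τ (τ x) ≡ x) where

  fill-datum : ∀ {k l m n} → Up k m → Down m n → Down k l → Up l n →
               ∀ {k₁ m₁ n₁ k₂ l₂ n₂} →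
               k₁ ≡ restrict σ m k m₁ → n₁ ≡ restrict σ m n m₁ →
               l₂ ≡ restrict τ k l k₂ → l₂ ≡ restrict τ n l n₂ →
               (k ≡ both → info k k₁ ≡ info k k₂) → Agree l n n₁ n₂ →
               ∃[ m₂ ] k₂ ≡ restrict τ m k m₂ × n₂ ≡ restrict τ m n m₂ ×
                       Agree k m m₁ m₂ × Agree m n n₁ n₂
  fill-datum km mn kl ln refl refl eq eq′ = fill ττ km mn kl ln _ _ _ (trans (sym eq) eq′)

  -- `fill-datum` supplies the middle cell; its condition on squares is `over-both` for the runs
  -- before the two steps.
  parallelise-follow : Follows (flipᴿ (Serialise {X = Twisted ls σ})) (flipᴿ (Serialise {X = Twisted ls τ}))
  parallelise-follow (rel (extend (extend o (down {q = p₂}) _) (up {q = q₂}) ok))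
                     (lower-up {p = p} {q} {p′} {q′} a b c)
    with fill-datum (δ-up ls p) (δ-down ls q) (δ-down ls p′) (δ-up ls q′)
           (δ-datum ls p) (δ-datum ls q) (δ-datum ls p₂) (δ-datum ls q₂) (over-both o) ok
  ... | _ , e , e′ , ok₁ , ok₂ =
    _ , up _ (δ-with ls p e) , down _ (δ-with ls q e′) , lower-up a b c ,
    rel (extend (extend o up ok₁) down ok₂)
  parallelise-follow (rel (extend (extend o (down {q = p₂}) _) (up {q = q₂}) ok))
                     (lower-down {p = p} {q} {p′} {q′} a b c)
    with fill-datum (δ-up ls p) (δ-down ls q) (δ-down ls p′) (δ-up ls q′)
           (δ-datum ls p) (δ-datum ls q) (δ-datum ls p₂) (δ-datum ls q₂) (over-both o) ok
  ... | _ , e , e′ , ok₁ , ok₂ =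
    _ , up _ (δ-with ls p e) , down _ (δ-with ls q e′) , lower-down a b c ,
    rel (extend (extend o up ok₁) down ok₂)

  step-follow : ∀ {U} {F : Face ls U} {d d₂}
                {α : Run (Twisted ls σ) (U , F , d)} {β : Run (Twisted ls τ) (U , F , d₂)} {y} →
                Over Agree α β → (s : Step (Twisted ls σ) (U , F , d) y) →
                ∃[ y₂ ] ∃ λ (t : Step (Twisted ls τ) (U , F , d₂) y₂) →
                Related Agree (_ , α ▷ s) (_ , β ▷ t)
  step-follow {d₂ = d₂} o (up i p)
    with up-follow (δ-up ls p) _ d₂ (λ eq → trans (cong (info _) (sym (δ-datum ls p))) (over-both o eq))
  ... | _ , e , ok = _ , up i (δ-with ls p e) , rel (extend o up ok)
  step-follow o (down i p) =
    _ , down i (δ-with ls p refl) , rel (extend o down (down-agree (δ-down ls p) _ _))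

  path-follow : ∀ {α α′ : Path (Twisted ls σ)} {β : Path (Twisted ls τ)} →
                Related Agree α β → α ↪ α′ → ∃[ β′ ] β ↪ β′ × Related Agree α′ β′
  path-follow r done = _ , done , r
  path-follow r (extend s α↪) with path-follow r α↪
  ... | _ , β↪ , rel o with step-follow o s
  ...   | _ , t , r′ = _ , extend t β↪ , r′

  qhp-simulation : IsSimulation qhp (Related {ls = ls} {σ} {τ} Agree)
  qhp-simulation = record
    { empty   = rel init
    ; trace   = λ { (rel o) → over-trace o }
    ; forward = path-follow
    -- `α ⊑[ ℓ ] α′` is a replacement leading from `α′` to `α`, whence the flips.
    ; ⊑-move  = λ _ r ρ → map₂ (λ (ρ′ , r′) → replace-unflip ρ′ , r′)
                            (replace-follow parallelise-follow r (replace-flip ρ))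
    ; ⊒-move  = λ { (inj₁ ()) ; (inj₂ ()) }
    ; ⇆-move  = λ where
        _ r (inj₁ ρ) → map₂ (λ (ρ′ , r′) → inj₁ (replace-unflip ρ′) , r′)
                            (replace-follow unswap-follow r (replace-flip ρ))
        _ r (inj₂ ρ) → map₂ (λ (ρ′ , r′) → inj₂ ρ′ , r′) (replace-follow swap-follow r ρ)
    ; ↩-move  = λ { (inj₁ ()) ; (inj₂ ()) }
    }

module _ {Act : Set} where

  -- Used for `back`: the flipped relation is only logically equivalent to `Related Agree` with the
  -- twists exchanged.
  simulation-resp : ∀ {I : Pred Symbol 0ℓ} {Y Z : HDA Act} {R S : REL (Path Y) (Path Z) 0ℓ} →
                    (∀ {α β} → R α β → S α β) → (∀ {α β} → S α β → R α β) →
                    IsSimulation I R → IsSimulation I S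
  simulation-resp to from sim = record
    { empty   = to empty
    ; trace   = trace ∘ from
    ; forward = λ s m → map₂ (map₂ to) (forward (from s) m)
    ; ⊑-move  = λ i s m → map₂ (map₂ to) (⊑-move i (from s) m)
    ; ⊒-move  = λ i s m → map₂ (map₂ to) (⊒-move i (from s) m)
    ; ⇆-move  = λ i s m → map₂ (map₂ to) (⇆-move i (from s) m)
    ; ↩-move  = λ i s m → map₂ (map₂ to) (↩-move i (from s) m)
    }
    where open IsSimulation sim

  qhp-bisimilar : ∀ {ls : Vec Act 3} {σ τ} → (∀ x → σ (σ x) ≡ x) → (∀ x → τ (τ x) ≡ x) →
                  Twisted ls σ ↔[ qhp ] Twisted ls τ
  qhp-bisimilar σσ ττ = Related Agree , record
    { there = qhp-simulation ττ
    ; back  = simulation-resp (λ { (rel o) → rel (over-sym o) }) (λ { (rel o) → rel (over-sym o) })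
                              (qhp-simulation σσ)
    }

  hp⇒qhp : ∀ {Y Z : HDA Act} → Y ↔[ hp ] Z → Y ↔[ qhp ] Z
  hp⇒qhp (R , bisim) = R , record { there = weaken there ; back = weaken back }
    where
    open IsBisimulation bisim
    weaken : ∀ {Y Z : HDA Act} {R : REL (Path Y) (Path Z) 0ℓ} → IsSimulation hp R → IsSimulation qhp R
    weaken sim = record
      { empty   = empty
      ; trace   = trace
      ; forward = forward
      ; ⊑-move  = λ _ → ⊑-move (inj₁ refl)
      ; ⊒-move  = λ _ → ⊒-move (inj₂ (inj₁ refl))
      ; ⇆-move  = λ _ → ⇆-move (inj₂ (inj₂ refl))
      ; ↩-move  = λ { (inj₁ ()) ; (inj₂ ()) }
      }
      where open IsSimulation sim

-- Recovering faces from ST-traces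

∷ʳ≢[] : ∀ {A : Set} (xs : List A) {x} → [] ≢ xs ∷ʳ x
∷ʳ≢[] []      ()
∷ʳ≢[] (_ ∷ _) ()

Always : Comparison
Always _ _ _ _ = ⊤

module _ {Act : Set} {ls : Vec Act 3} (ls-injective : ∀ i j → lookup ls i ≡ lookup ls j → i ≡ j)
  where

  open Face

  δ-face : ∀ {σ U V} {F : Face ls U} {G : Face ls V} {d e k i} →
           (U , F , d) ≡ δ (Twisted ls σ) k (V , G , e) i → (U , F) ≡ δᶠ k (V , G) i
  δ-face {V = suc _ , _} refl = refl

  axis-unique : ∀ {U V} (F : Face ls U) (G : Face ls V) {i j} → label U i ≡ label V j →
                lookup (axes F) i ≡ lookup (axes G) j
  axis-unique F G eq = ls-injective _ _ (trans (sym (label-axis F _)) (trans eq (label-axis G _)))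

  -- With distinct labels an entry of the trace determines an axis. An up-step is then fixed by
  -- `lower-face-unique`, a down-step by its source and index.
  trace-over : ∀ {σ τ x y} (α : Run (Twisted ls σ) x) (β : Run (Twisted ls τ) y) →
               traceOf α ≡ traceOf β →
               Related Always (x , α) (y , β)
  trace-over init init _ = rel init
  trace-over init (β ▷ up _ _)   eq = contradiction eq (∷ʳ≢[] _)
  trace-over init (β ▷ down _ _) eq = contradiction eq (∷ʳ≢[] _)
  trace-over (α ▷ up _ _)   init eq = contradiction (sym eq) (∷ʳ≢[] _)
  trace-over (α ▷ down _ _) init eq = contradiction (sym eq) (∷ʳ≢[] _)
  trace-over (_▷_ {y = V , G , _} α (up i p)) (_▷_ {y = V′ , G′ , _} β (up j q)) eq
    with trace-over α β (∷ʳ-injectiveˡ _ _ eq) | ∷ʳ-injectiveʳ (traceOf α) _ eq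
  ... | rel o | entry with lower-face-unique G G′ i j (δ-face p) (δ-face q)
                         (axis-unique G G′ (⁺-injective entry))
    where
    ⁺-injective : ∀ {k l : Act} → (k ⁺) ≡ (l ⁺) → k ≡ l
    ⁺-injective refl = refl
  ... | refl = rel (extend o up tt)
  trace-over (_▷_ {x = U , F , _} α (down i p)) (_▷_ {x = U′ , F′ , _} β (down j q)) eq
    with trace-over α β (∷ʳ-injectiveˡ _ _ eq) | ∷ʳ-injectiveʳ (traceOf α) _ eq
  ... | rel o | entry with axes-injective F (axis-unique F F (^-injective entry))
    where
    ^-injective : ∀ {k l : Act} {m n} → k ^ m ≡ l ^ n → k ≡ l
    ^-injective refl = refl
  trace-over (_▷_ {x = (suc _ , _) , _} α (down i refl)) (_▷_ {x = (suc _ , _) , _} β (down .i refl)) eq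
    | rel o | entry | refl = rel (extend o down tt)
  trace-over (α ▷ up _ _)   (β ▷ down _ _) eq with () ← ∷ʳ-injectiveʳ (traceOf α) _ eq
  trace-over (α ▷ down _ _) (β ▷ up _ _)   eq with () ← ∷ʳ-injectiveʳ (traceOf α) _ eq

-- Cells kept by a replacement

module _ {Act : Set} {X : HDA Act} where

  cellAt : ∀ {x} → Run X x → ℕ → Cell X
  -- This is also the default for positions beyond the end of the run.
  cellAt init             _ = initialCell X
  cellAt (_▷_ {y = y} α _) k = if k ≡ᵇ suc (length α) then y else cellAt α k

  replace-cell : ∀ {P : Replacement {X = X}} {ℓ α β} → Replace P ℓ α β → ∀ {k} → k ≢ ℓ →
                 cellAt (proj₂ α) k ≡ cellAt (proj₂ β) k
  replace-cell (here {z = z} {α = α} _) {k} k≢ℓ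
    with k ≡ᵇ suc (length α) in eq
  ... | true  = contradiction (≡ᵇ⇒≡ k _ (subst T (sym eq) tt)) k≢ℓ
  ... | false = refl
  replace-cell (later {y = y} s r) {k} k≢ℓ =
    cong₂ (λ n c → if k ≡ᵇ suc n then y else c) (replace-length r) (replace-cell r k≢ℓ)

  swap-cell : ∀ {ℓ} {α β : Path X} → α ⇆[ ℓ ] β → ∀ {k} → k ≢ ℓ →
              cellAt (proj₂ α) k ≡ cellAt (proj₂ β) k
  swap-cell (inj₁ r) k≢ℓ = replace-cell r k≢ℓ
  swap-cell (inj₂ r) k≢ℓ = sym (replace-cell r k≢ℓ)

-- The obstruction to hp-bisimilarity

-- The path A₀ goes through the cube q above the square t₁, and A₃ through the
-- square t₂, which bounds no cube.  They have the same last two cells, and A₂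
-- is below both A₀ and A₃.  In Twisted ls not, the edge below the cube q′ only
-- bounds the square t of q′, so that a path matching A₃ can be moved back into
-- q′, whereas A₃ cannot be moved into a cube.
record Detour {Act : Set} (ls : Vec Act 3) : Set where
  private Y = Twisted ls id
  field
    {Uₓ Uₜ Uₘ Uₑ U₊ Uₑ₊ U} : Conclist Act
    {Fₓ}  : Face ls Uₓ
    {Fₜ}  : Face ls Uₜ
    {Fₘ}  : Face ls Uₘ
    {Fₑ}  : Face ls Uₑ
    {F₊}  : Face ls U₊
    {Fₑ₊} : Face ls Uₑ₊
    {F}   : Face ls U
    {x}     : Datum (kindOf ls Fₓ)
    {t₁ t₂} : Datum (kindOf ls Fₜ)
    {m}     : Datum (kindOf ls Fₘ)
    {e}     : Datum (kindOf ls Fₑ)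
    {q}     : Datum (kindOf ls F₊)
    {e₊}    : Datum (kindOf ls Fₑ₊)
    {z}     : Datum (kindOf ls F)
    {i}  : Fin (dim Uₜ)
    {k l} : Fin (dim U₊)
    {k′} : Fin (dim Uₑ₊)
    first : Step Y (initialCell Y) (Uₓ , Fₓ , x)
    u₁    : Step Y (Uₓ , Fₓ , x) (Uₜ , Fₜ , t₁)
    u₂    : Step Y (Uₓ , Fₓ , x) (Uₜ , Fₜ , t₂)
    v₁    : (Uₑ , Fₑ , e) ≡ δ Y 1₂ (Uₜ , Fₜ , t₁) i
    v₂    : (Uₑ , Fₑ , e) ≡ δ Y 1₂ (Uₜ , Fₜ , t₂) i
    v′    : Step Y (Uₓ , Fₓ , x) (Uₘ , Fₘ , m)
    u′    : Step Y (Uₘ , Fₘ , m) (Uₑ , Fₑ , e)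
    c     : (Uₜ , Fₜ , t₁) ≡ δ Y 0₂ (U₊ , F₊ , q) k
    w     : (Uₑ₊ , Fₑ₊ , e₊) ≡ δ Y 1₂ (U₊ , F₊ , q) l
    c′    : (Uₑ , Fₑ , e) ≡ δ Y 0₂ (Uₑ₊ , Fₑ₊ , e₊) k′
    last  : Step Y (Uₑ₊ , Fₑ₊ , e₊) (U , F , z)
    l<k   : toℕ l ℕ.< toℕ k
    k≡    : toℕ k ≡ suc (toℕ k′)
    l≡i   : toℕ l ≡ toℕ i
    ser₁  : Serialise u₁ (down i v₁) v′ u′
    ser₂  : Serialise u₂ (down i v₂) v′ u′
    t₂-outside : ∀ q → t₂ ≢ restrict id (kindOf ls F₊) (kindOf ls Fₜ) q
    q′         : Datum (kindOf ls F₊)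
    t-inside   : ∀ t →
      restrict not (kindOf ls Fₜ) (kindOf ls Fₑ) t ≡
      restrict not (kindOf ls Fₑ₊) (kindOf ls Fₑ) (restrict not (kindOf ls F₊) (kindOf ls Fₑ₊) q′) →
      t ≡ restrict not (kindOf ls F₊) (kindOf ls Fₜ) q′

  e₊′ : Datum (kindOf ls Fₑ₊)
  e₊′ = restrict not (kindOf ls F₊) (kindOf ls Fₑ₊) q′

  A₀ A₁ A₂ A₃ : Path Y
  A₀ = _ , init ▷ first ▷ u₁ ▷ up k c ▷ down l w ▷ last
  A₁ = _ , init ▷ first ▷ u₁ ▷ down i v₁ ▷ up k′ c′ ▷ last
  A₂ = _ , init ▷ first ▷ v′ ▷ u′ ▷ up k′ c′ ▷ last
  A₃ = _ , init ▷ first ▷ u₂ ▷ down i v₂ ▷ up k′ c′ ▷ last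

  ∅↪A₀ : emptyPath ↪ A₀
  ∅↪A₀ = extend last (extend (down l w) (extend (up k c) (extend u₁ (extend first done))))

  A₁⊑A₀ : A₁ ⊑[ 3 ] A₀
  A₁⊑A₀ = later last (here (lower-down l<k k≡ l≡i))

  A₂⊑A₁ : A₂ ⊑[ 2 ] A₁
  A₂⊑A₁ = later last (later (up k′ c′) (here ser₁))

  A₂⊑A₃ : A₂ ⊑[ 2 ] A₃
  A₂⊑A₃ = later last (later (up k′ c′) (here ser₂))

module _ {Act : Set} {ls : Vec Act 3} (ls-injective : ∀ i j → lookup ls i ≡ lookup ls j → i ≡ j)
  {R : REL (Path (Twisted ls id)) (Path (Twisted ls not)) 0ℓ} (R-bisim : IsBisimulation hp R) where

  open IsBisimulation R-bisim

  related-over : ∀ {α β} → R α β → Related Always α β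
  related-over {α} {β} r = trace-over ls-injective (proj₂ α) (proj₂ β) (IsSimulation.trace there r)

  module _ (G : Detour ls) where

    open Detour G

    A₃-unmatched : ∀ {β} → R A₃ β → cellAt (proj₂ β) 4 ≢ (Uₑ₊ , Fₑ₊ , e₊′)
    A₃-unmatched r₃ eq₄ with related-over r₃
    A₃-unmatched r₃ refl
      | rel (extend {t = s} (extend {t = p} (extend {t = d} (extend {t = u} (extend {t = f} init _ _) _ _)
               (down {q = r}) _) (up {q = p′}) _) _ _)
      -- By `t-inside` the square visited by `β` lies under `q′`, so `β` is subsumed by a path
      -- through that cube, which `A₃` has to answer.
      with α₄ , ρ₄ , r₄ ← IsSimulation.⊑-move back (inj₁ refl) {ℓ = 3}
             {α′ = _ , init ▷ f ▷ u
                       ▷ up k (δ-with ls c (t-inside _ (trans (sym (δ-datum ls r)) (δ-datum ls p′))))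
                       ▷ down l (δ-with ls w refl) ▷ s}
             r₃ (later _ (here (lower-down l<k k≡ l≡i)))
      -- The answer passes through a cube at position 3 and still has `t₂` at position 2, against
      -- `t₂-outside`.
      with related-over r₄ | replace-cell ρ₄ {2} (λ ())
    ... | rel (extend (extend (extend (extend (extend init _ _) _ _) (up {p = p}) _) _ _) _ _) | refl =
      t₂-outside _ (δ-datum ls p)

    -- The moves from `A₀` over `A₁` and `A₂` to `A₃` take place at positions 3, 2 and 2, so the
    -- matching paths keep their cell at 4.
    A₀-unmatched′ : ∀ {β} → R A₀ β → cellAt (proj₂ β) 4 ≢ (Uₑ₊ , Fₑ₊ , e₊′)
    A₀-unmatched′ r₀ cell₄
      with β₁ , ρ₁ , r₁ ← IsSimulation.⊒-move there (inj₂ (inj₁ refl)) r₀ A₁⊑A₀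
      with β₂ , ρ₂ , r₂ ← IsSimulation.⊒-move there (inj₂ (inj₁ refl)) r₁ A₂⊑A₁
      with β₃ , ρ₃ , r₃ ← IsSimulation.⊑-move there (inj₁ refl) r₂ A₂⊑A₃
      = A₃-unmatched r₃ (trans (replace-cell ρ₃ {4} (λ ())) (trans (sym (replace-cell ρ₂ {4} (λ ())))
          (trans (sym (replace-cell ρ₁ {4} (λ ()))) cell₄)))

    A₀-cube : ∀ {β} → R A₀ β → ∃[ q ] cellAt (proj₂ β) 3 ≡ (U₊ , F₊ , q)
    A₀-cube r with related-over r
    ... | rel (extend (extend (extend (extend (extend init _ _) _ _) _ _) _ _) _ _) = _ , refl

    -- The cell at 4 is an upper face of the cube at 3, hence determined by `q′`.
    A₀-unmatched : ∀ {β} → R A₀ β → cellAt (proj₂ β) 3 ≢ (U₊ , F₊ , q′)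
    A₀-unmatched r eq with related-over r
    A₀-unmatched r refl | rel (extend (extend (extend (extend (extend init _ _) _ _) _ _) (down {q = w}) _) _ _) =
      A₀-unmatched′ r (cong (λ d → Uₑ₊ , Fₑ₊ , d) (δ-datum ls w))

-- The two detours and the conclusion

cell-≡ : ∀ {Act : Set} {ls : Vec Act 3} {U} {F G : Face ls U}
         {d : Datum (kindOf ls F)} {e : Datum (kindOf ls G)} →
         Face.axes F ≡ Face.axes G → (eq : Face.coords F ≡ Face.coords G) →
         subst (Datum ∘ kind) eq d ≡ e →
         _≡_ {A = Σ (Conclist Act) λ U → Σ (Face ls U) λ F → Datum (kindOf ls F)} (U , F , d) (U , G , e)
cell-≡ {U = U} {face a c p _} {face _ _ q z} {d} refl refl refl =
  cong (λ l → U , face a c l z , d) (uip p q)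

module _ {Act : Set} (a b c : Act)
  (labels-injective : ∀ i j → lookup (a ∷ b ∷ c ∷ []) i ≡ lookup (a ∷ b ∷ c ∷ []) j → i ≡ j) where

  private
    abc : Vec Act 3
    abc = a ∷ b ∷ c ∷ []
    Y Z : HDA Act
    Y = Twisted abc id
    Z = Twisted abc not

  top : Face abc (3 , abc)
  top = face (allFin 3) (replicate 3 *) refl record
    { injective = λ {s} {t} eq → trans (sym (lookup-allFin s)) (trans eq (lookup-allFin t))
    ; monotone  = λ {s} {t} → subst₂ _≤ᶠ_ (sym (lookup-allFin s)) (sym (lookup-allFin t))
    ; image     = λ u → mk⇔ (λ _ → _,_ {B = λ t → lookup (allFin 3) t ≡ u} u (lookup-allFin u))
                            (λ _ → lookup-replicate u *)
    }

  -- `onlyB₁` and `onlyA₁` carry the datum `true`. Since `Y` is untwisted, they bound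
  -- `square (just true)` as well as `square nothing`.
  cube edgeA edgeB afterA afterB onlyB₁ onlyA₁ onlyB⁺ onlyA⁺ end : Cell Y
  square : Maybe Bool → Cell Y
  cube     = (3 , abc) , top , true
  square d = (2 , a ∷ b ∷ []) , top · coface 0₂ abc (suc (suc zero)) , d
  edgeA    = δ Y 0₂ (square nothing) (suc zero)
  edgeB    = δ Y 0₂ (square nothing) zero
  afterA   = δ Y 1₂ edgeA zero
  afterB   = δ Y 1₂ edgeB zero
  onlyB₁   = δ Y 1₂ (square nothing) zero
  onlyA₁   = δ Y 1₂ (square nothing) (suc zero)
  onlyB⁺   = δ Y 1₂ cube zero
  onlyA⁺   = δ Y 1₂ cube (suc zero)
  end      = δ Y 1₂ onlyB⁺ zero

  faceOf : (x : Cell Y) → Face abc (proj₁ x)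
  faceOf (_ , F , _) = F

  startA : Step Y (initialCell Y) edgeA
  startA = up zero (cell-≡ refl refl refl)
  startB : Step Y (initialCell Y) edgeB
  startB = up zero (cell-≡ refl refl refl)
  upB : ∀ d → Step Y edgeA (square d)
  upB d = up (suc zero) refl
  upA : ∀ d → Step Y edgeB (square d)
  upA d = up zero refl
  finishB : Step Y onlyB⁺ end
  finishB = down zero refl
  finishA : Step Y onlyA⁺ end
  finishA = down zero (cell-≡ refl refl refl)

  via-onlyB : Detour abc
  via-onlyB = record
    { Fₓ = faceOf edgeA
    ; Fₜ = faceOf (square nothing)
    ; Fₘ = faceOf afterA
    ; Fₑ = faceOf onlyB₁
    ; F₊ = top
    ; Fₑ₊ = faceOf onlyB⁺
    ; F = faceOf end
    ; i = zero ; k = suc (suc zero) ; k′ = suc zero ; l = zero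
    ; first = startA
    ; u₁ = upB (just true)
    ; u₂ = upB nothing
    ; v₁ = refl {x = onlyB₁}
    ; v₂ = refl
    ; v′ = down zero (refl {x = afterA})
    ; u′ = up zero (cell-≡ refl refl refl)
    ; c = refl
    ; w = refl {x = onlyB⁺}
    ; c′ = cell-≡ refl refl refl
    ; last = finishB
    ; l<k = s≤s z≤n
    ; k≡ = refl
    ; l≡i = refl
    ; ser₁ = lower-down (s≤s z≤n) refl refl
    ; ser₂ = lower-down (s≤s z≤n) refl refl
    ; t₂-outside = λ q ()
    -- In `Z` this cube has the `onlyB` edge `false`, which among the squares bounds only
    -- `just false`.
    ; q′ = false
    ; t-inside = λ { (just false) refl → refl }
    }

  via-onlyA : Detour abc
  via-onlyA = record
    { Fₓ = faceOf edgeB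
    ; Fₜ = faceOf (square nothing)
    ; Fₘ = faceOf afterB
    ; Fₑ = faceOf onlyA₁
    ; F₊ = top
    ; Fₑ₊ = faceOf onlyA⁺
    ; F = faceOf end
    ; i = suc zero ; k = suc (suc zero) ; k′ = suc zero ; l = suc zero
    ; first = startB
    ; u₁ = upA (just true)
    ; u₂ = upA nothing
    ; v₁ = refl {x = onlyA₁}
    ; v₂ = refl
    ; v′ = down zero (refl {x = afterB})
    ; u′ = up zero (cell-≡ refl refl refl)
    ; c = refl
    ; w = refl {x = onlyA⁺}
    ; c′ = cell-≡ refl refl refl
    ; last = finishA
    ; l<k = s≤s (s≤s z≤n)
    ; k≡ = refl
    ; l≡i = refl
    ; ser₁ = lower-up (s≤s z≤n) refl refl
    ; ser₂ = lower-up (s≤s z≤n) refl refl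
    ; t₂-outside = λ q ()
    -- Here the twist turns `true` into the `onlyA` edge `false`, which bounds only `just true`.
    ; q′ = true
    ; t-inside = λ { (just true) refl → refl }
    }

  upC : Step Y (square (just true)) cube
  upC = up (suc (suc zero)) refl
  endB : Step Y cube onlyA⁺
  endB = down (suc zero) refl

  bothA bothB : Path Y
  bothA = Detour.A₀ via-onlyA
  bothB = Detour.A₀ via-onlyB

  -- Halfway between `bothB` and `bothA`, which differ in the order of both the starts and the ends
  -- of a and b.
  downs-swapped : Path Y
  downs-swapped = _ , init ▷ startA ▷ upB (just true) ▷ upC ▷ endB ▷ finishA

  swap-downs : downs-swapped ⇆[ 4 ] bothB
  swap-downs = inj₁ (here (down-down (s≤s z≤n) refl refl))

  swap-ups : bothA ⇆[ 1 ] downs-swapped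
  swap-ups = inj₂ (later finishA (later endB (later upC
               (here (up-up (s≤s z≤n) refl refl)))))

  not-hp : ¬ (Y ↔[ hp ] Z)
  not-hp (R , bisim) =
    let _ , _ , r = IsSimulation.forward there (IsSimulation.empty there) (Detour.∅↪A₀ via-onlyB)
        _ , cell₃ = A₀-cube labels-injective bisim via-onlyB r
    in  bothB-unmatched _ r cell₃
    where
    open IsBisimulation bisim

    -- Each cube of `Z` has one edge `false`: `onlyB` for the cube `false`, `onlyA` for the cube
    -- `true`. The matching detour applies.
    bothB-unmatched : ∀ q {β} → R bothB β → cellAt (proj₂ β) 3 ≢ ((3 , abc) , top , q)
    bothB-unmatched false r cell₃ = A₀-unmatched labels-injective bisim via-onlyB r cell₃
    bothB-unmatched true  r cell₃ =
      -- The swaps at 4 and 1 lead to `bothA` and leave the cube at 3 unchanged.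
      let _ , ρ₁ , r₁ = IsSimulation.⇆-move there (inj₂ (inj₂ refl)) r swap-downs
          _ , ρ₂ , r₂ = IsSimulation.⇆-move there (inj₂ (inj₂ refl)) r₁ swap-ups
      in  A₀-unmatched labels-injective bisim via-onlyA r₂
            (trans (swap-cell ρ₂ (λ ())) (trans (swap-cell ρ₁ (λ ())) cell₃))

corollary5p13 : (Act : Set) (a b c d : Act) → Unique (a ∷ b ∷ c ∷ d ∷ []) →
    ((Y Z : HDA Act) → Y ↔[ hp ] Z → Y ↔[ qhp ] Z) ×
    (∃₂ λ (Y Z : HDA Act) → Y ↔[ qhp ] Z × ¬ (Y ↔[ hp ] Z))
corollary5p13 Act a b c d
  ((a≢b List.∷ a≢c List.∷ _) List.∷ (b≢c List.∷ _) List.∷ _) =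
  (λ _ _ → hp⇒qhp) ,
  Twisted abc id , Twisted abc not ,
  qhp-bisimilar (λ _ → refl) not-involutive ,
  not-hp a b c (lookup-injective unique)
  where
  abc : Vec Act 3
  abc = a ∷ b ∷ c ∷ []

  unique = (a≢b Vec.∷ a≢c Vec.∷ Vec.[]) Vec.∷ (b≢c Vec.∷ Vec.[]) Vec.∷ Vec.[] Vec.∷ Vec.[]
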